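{- Let $n\ge 2$ with prime factorization $n=\prod_j p_j^{a_j}$ (distinct primes $p_j$) and let $m=\min_j p_j^{a_j}$. Then the maximum $q$ such that there exists a simply transitive set of $q$ mutually orthogonal Latin squares of order $n$ equals $m-1$.
   Context: A set of $q$ MOLS of order $n$ is identified with an orthogonal array $(S,X_i,\pi_i)_{i=1}^{q+2}$: sets $X_i$ with $|X_i|=n$ and maps $\pi_i\colon S\to X_i$ such that $\pi_i\times\pi_j\colon S\to X_i\times X_j$ is a bijection for all $i\ne j$ (two coordinates index rows and columns, the rest give the symbols of the $q$ squares). Regarding $S\subset\prod_iX_i$ via $\prod_i\pi_i$, the autotopy group is $\{(\sigma_i)\in\prod_i\mathrm{Sym}(X_i):(\sigma_i)(S)=S\}$. The set of MOLS is simply transitive if some subgroup of its autotopy group acts simply transitively on $S$. -}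

module Defs where

open import Level using (0ℓ)
open import Data.Nat using (ℕ; suc; _+_; _^_; _≤_)
open import Data.Nat.Divisibility using (_∣_)
open import Data.Nat.Primality using (Prime)
open import Data.Fin using (Fin)
open import Data.Fin.Permutation using (Permutation′; _⟨$⟩ʳ_; id; flip; _∘ₚ_)
open import Data.Product using (Σ; _×_; _,_; ∃; ∃-syntax)
open import Function.Definitions using (Bijective)
open import Relation.Binary.PropositionalEquality using (_≡_; _≢_)
open import Relation.Nullary using (¬_)

record OrthogonalArray (k n : ℕ) : Set₁ where
  field
    S   : Set
    π   : Fin k → S → Fin n
    orth : ∀ (i j : Fin k) → i ≢ j →
           Bijective _≡_ _≡_ (λ (s : S) → (π i s , π j s))

MOLS : ℕ → ℕ → Set₁
MOLS q n = OrthogonalArray (q + 2) n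

module _ {k n : ℕ} (A : OrthogonalArray k n) where
  open OrthogonalArray A

  Tuple : Set
  Tuple = Fin k → Permutation′ n

  _≈T_ : Tuple → Tuple → Set
  σ ≈T τ = ∀ i x → σ i ⟨$⟩ʳ x ≡ τ i ⟨$⟩ʳ x

  idT : Tuple
  idT i = id

  compT : Tuple → Tuple → Tuple
  compT σ τ i = σ i ∘ₚ τ i

  invT : Tuple → Tuple
  invT σ i = flip (σ i)

  -- (σ_i) sends the point s of S ⊂ Π X_i to the point t of S.
  Sends : Tuple → S → S → Set
  Sends σ s t = ∀ i → π i t ≡ σ i ⟨$⟩ʳ π i s

  IsAutotopy : Tuple → Set
  IsAutotopy σ = (∀ s → ∃[ t ] Sends σ s t) × (∀ t → ∃[ s ] Sends σ s t)

  record AutotopySubgroup : Set₁ where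
    field
      Mem     : Tuple → Set
      mem-aut : ∀ σ → Mem σ → IsAutotopy σ
      mem-id  : Mem idT
      mem-∘   : ∀ σ τ → Mem σ → Mem τ → Mem (compT σ τ)
      mem-inv : ∀ σ → Mem σ → Mem (invT σ)

  ActsSimplyTransitively : AutotopySubgroup → Set
  ActsSimplyTransitively G =
    (∀ s t → ∃[ σ ] (Mem σ × Sends σ s t)) ×
    (∀ s t σ τ → Mem σ → Mem τ → Sends σ s t → Sends τ s t → σ ≈T τ)
    where open AutotopySubgroup G

  IsSimplyTransitive : Set₁
  IsSimplyTransitive = Σ AutotopySubgroup ActsSimplyTransitively

ExistsSTMOLS : ℕ → ℕ → Set₁
ExistsSTMOLS q n = Σ (MOLS q n) IsSimplyTransitive

IsPrimePowerFactor : ℕ → ℕ → ℕ → Set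
IsPrimePowerFactor n p a = Prime p × 1 ≤ a × (p ^ a ∣ n) × ¬ (p ^ suc a ∣ n)

IsMinPrimePowerFactor : ℕ → ℕ → Set
IsMinPrimePowerFactor n m =
  (∃[ p ] ∃[ a ] (IsPrimePowerFactor n p a × m ≡ p ^ a)) ×
  (∀ p a → IsPrimePowerFactor n p a → m ≤ p ^ a)

IsMaxSTMOLS : ℕ → ℕ → Set₁
IsMaxSTMOLS n q = ExistsSTMOLS q n × (∀ q′ → ExistsSTMOLS q′ n → q′ ≤ q)

{-# OPTIONS --safe #-}
module Submission where

-- A simply transitive group G has order n² and acts on every Xᵢ; by orthogonality, an element fixing a point in two
-- different Xᵢ is trivial. If pᵃ is the p-part of n, a Sylow p-subgroup P of G, of order p²ᵃ, has on each Xᵢ an orbit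
-- of length at most pᵃ, hence a point stabiliser of order at least pᵃ. These q + 2 subgroups of P intersect trivially
-- in pairs, so (q + 2)(pᵃ − 1) < p²ᵃ and q + 2 ≤ pᵃ + 1.
--
-- Conversely, an abelian group A of order n with m endomorphisms eᵢ whose pairwise differences are injective gives the
-- array on A × A with coordinates x and y + eᵢ(x), on which the translations act simply transitively. For A take the
-- product of fields of orders pᵃ ≥ m. The field of order Q = pᵃ is found in R = 𝔽ₚ[t]/(t^(Q−1) − 1), in which
-- r^Q = r for all r, by Frobenius: the element y = ∏_{0<d<a} (t^(p^d) − t) is nonzero for degree reasons, and a
-- primitive idempotent e below y^(Q−1) cuts out a field eR. Its order is a power pˢ by Lagrange and at most Q because
-- all its elements are roots of x^Q − x, while s < a would give e t^(pˢ) = e t and thus e y = 0.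

open import Defs
open import Data.Nat using (ℕ; zero; suc; _+_; _*_; _∸_; _^_; _≤_; _<_; z≤n; s≤s; s≤s⁻¹; NonZero; ≢-nonZero⁻¹; nonTrivial⇒n>1; >-nonZero)
open import Level using (0ℓ)
import Data.Nat.Properties as ℕ
open import Data.Nat.Combinatorics using (_C_; nCk+nC[k+1]≡[n+1]C[k+1]; nC1≡n; nCn≡1)
open import Data.Nat.Divisibility using (_∣_; _∤_; divides; _∣?_; ∣m∣n⇒∣m+n; ∣m+n∣m⇒∣n; *-cancelʳ-∣; *-monoˡ-∣; m∣m*n; n∣m*n; ∣-trans; ∣⇒≤; ∣1⇒≡1; 1∣_; _∣0; quotient-<)
open import Data.Nat.DivMod using (_%_; _mod_; m%n<n; %-distribˡ-+; m<n⇒m%n≡m; n%n≡0; m*n%n≡0)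
open import Data.Nat.Induction using (<-wellFounded)
open import Data.Nat.Primality using (Prime; euclidsLemma; prime⇒nonZero; prime⇒nonTrivial; prime⇒irreducible)
open import Data.Nat.Primality.Factorisation using (factorise)
open import Data.Nat.Solver using (module +-*-Solver)
open import Data.Bool using (Bool; true; false)
import Data.Bool.Properties as Bool
open import Data.Fin as Fin using (Fin; zero; suc; toℕ; fromℕ; fromℕ<; inject₁; inject≤; combine; remQuot)
open import Data.Fin.Permutation as Permutation using (permutation; _⟨$⟩ʳ_; _⟨$⟩ˡ_)
import Data.Fin.Properties as Fin
open import Data.Fin.Properties using (suc-injective; toℕ-injective; toℕ-fromℕ; toℕ-fromℕ<; toℕ-inject₁; toℕ<n; remQuot-combine; combine-remQuot; inject≤-injective; *↔×; 1↔⊤)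
open import Data.List as List using (List; []; _∷_; _++_; length; filter; map; foldr; concat; allFin; cartesianProductWith)
open import Data.List.Properties using (length-++; length-map; length-tabulate; length-filter; filter-reject)
open import Data.List.Membership.Propositional using (_∈_; lose; find)
open import Data.List.Membership.Propositional.Properties using (∈-∃++; ∈-++⁻; ∈-++⁺ˡ; ∈-++⁺ʳ; ∈-filter⁺; ∈-filter⁻; ∈-map⁻; ∈-map⁺; ∈-lookup; ∈-length; ∈-allFin; ∈-concat⁻′; ∈-cartesianProductWith⁺)
open import Data.List.Membership.Propositional.Properties.WithK using (unique∧set⇒bag)
open import Data.List.Relation.Binary.BagAndSetEquality using (∼bag⇒↭)
open import Data.List.Relation.Binary.Permutation.Propositional using (_↭_; ↭⇒↭ₛ)
import Data.List.Relation.Binary.Permutation.Setoid.Properties as ↭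
open import Data.List.Relation.Binary.Subset.Propositional using (_⊆_)
open import Data.List.Relation.Unary.All as All using (All; []; _∷_; all?)
import Data.List.Relation.Unary.All.Properties as Allₚ
open import Data.List.Relation.Unary.AllPairs as AllPairs using ([]; _∷_)
import Data.List.Relation.Unary.AllPairs.Properties as AllPairsₚ
open import Data.List.Relation.Unary.Any as Any using (Any; here; there; any?)
open import Data.List.Relation.Unary.Any.Properties using (lookup-index)
open import Data.List.Relation.Unary.Unique.Propositional using (Unique)
import Data.List.Relation.Unary.Unique.Propositional.Properties as Unique
open import Data.Maybe using (nothing)
open import Data.Product using (Σ; _×_; _,_; ∃-syntax; proj₁; proj₂)
open import Data.Product.Function.NonDependent.Propositional using (_×-↔_)
open import Data.Product.Properties using (,-injective)
open import Data.Sum using (inj₁; inj₂; [_,_]′)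
open import Data.Unit using (⊤; tt)
open import Data.Vec as Vec using (Vec; []; _∷_; _∷ʳ_; zipWith; replicate; initLast)
open import Data.Vec.Properties using (∷-injective; ∷-injectiveʳ; lookup∘tabulate; tabulate∘lookup; tabulate-cong; ≡-dec; zipWith-assoc; zipWith-comm; zipWith-identityˡ; zipWith-identityʳ; zipWith-inverseˡ; zipWith-inverseʳ)
open import Algebra.Bundles using (Group; AbelianGroup; CommutativeRing)
open import Algebra.Structures using (IsGroup; IsAbelianGroup; IsCommutativeRing)
import Algebra.Properties.CommutativeMonoid.Mult as Mult
import Algebra.Properties.CommutativeSemigroup as CommutativeSemigroupProperties
import Algebra.Properties.CommutativeSemiring.Binomial as Binomial
import Algebra.Properties.CommutativeSemiring.Exp as Exp
import Algebra.Properties.Group as GroupProperties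
import Algebra.Properties.Monoid.Sum as Sum
import Algebra.Properties.Ring as RingProperties
open import Axiom.UniquenessOfIdentityProofs.WithK using (uip)
open import Function using (_∘_; id; case_of_; mk⇔)
open import Function.Bundles using (_↔_; mk↔ₛ′; Inverse)
open import Function.Construct.Composition using (_↔-∘_)
open import Function.Construct.Symmetry using (↔-sym)
open import Function.Definitions using (Bijective)
open import Induction.WellFounded using (Acc; acc)
open import Relation.Binary using (DecidableEquality)
open import Relation.Binary.PropositionalEquality as ≡ using (_≡_; _≢_; refl; sym; trans; cong; cong₂; subst; isEquivalence; module ≡-Reasoning)
import Relation.Binary.Reasoning.Setoid as ≈-Reasoning
open import Relation.Nullary using (Dec; yes; no; contradiction; ¬?; _×-dec_)
open import Relation.Unary using (Pred; Decidable)
open import Tactic.RingSolver.Core.AlmostCommutativeRing using (fromCommutativeRing)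
import Tactic.RingSolver.NonReflective as RingSolver

-- Sylow subgroups let the bound see each prime separately: the same packing count for all of G,
-- whose point stabilisers have order n, yields only q + 2 ≤ n + 1. P need not be transitive on Xᵢ,
-- so the stabiliser is taken at a suitable point for each i; the choices are independent, since
-- fixing any point of Xᵢ and any point of Xⱼ forces the identity.
--
-- In the construction the obstacle is to get a field of prescribed order with no irreducible
-- polynomial of degree a at hand. R is explicit and finite, and primitive idempotents play the role
-- of maximal ideals because a finite search finds them. The element y is designed to vanish on
-- every field factor that is too small, which turns the existence of a large factor into a degree
-- computation.
--
-- The slopes of one field are the multiplications by all its elements; a product of fields keeps as
-- many as its smallest factor has. Together with the coordinate x, m slopes make m + 1 = q + 2
-- coordinates, which is where q = m - 1 comes from.

private variable
  A B : Set

-- Counting in lists without repetition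

length-mono-⊆ : {xs ys : List A} → Unique xs → xs ⊆ ys → length xs ≤ length ys
length-mono-⊆ {xs = []} _ _ = z≤n
length-mono-⊆ {xs = x ∷ xs} (x∉xs ∷ xs!) xs⊆ys with ∈-∃++ (xs⊆ys (here refl))
... | as , bs , refl = begin
  suc (length xs)             ≤⟨ s≤s (length-mono-⊆ xs! sub) ⟩
  suc (length (as ++ bs))     ≡⟨ cong suc (length-++ as) ⟩
  suc (length as + length bs) ≡⟨ ℕ.+-suc (length as) (length bs) ⟨
  length as + suc (length bs) ≡⟨ length-++ as ⟨
  length (as ++ x ∷ bs)       ∎
  where
  open ℕ.≤-Reasoning
  sub : xs ⊆ as ++ bs
  sub y∈xs with ∈-++⁻ as (xs⊆ys (there y∈xs))
  ... | inj₁ y∈as = ∈-++⁺ˡ y∈as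
  ... | inj₂ (here refl) = contradiction y∈xs (Allₚ.All¬⇒¬Any x∉xs)
  ... | inj₂ (there y∈bs) = ∈-++⁺ʳ as y∈bs

length-mono-injective : {xs : List A} {ys : List B} {f : A → B} → (∀ {x y} → f x ≡ f y → x ≡ y) →
  Unique xs → (∀ {x} → x ∈ xs → f x ∈ ys) → length xs ≤ length ys
length-mono-injective {xs = xs} {ys} {f} f-inj xs! f∈ =
  subst (_≤ length ys) (length-map f xs) (length-mono-⊆ (Unique.map⁺ f-inj xs!) λ z∈ →
    case ∈-map⁻ f z∈ of λ { (x , x∈ , refl) → f∈ x∈ })

length-filter-∁ : {P : Pred A 0ℓ} (P? : Decidable P) (xs : List A) →
  length xs ≡ length (filter P? xs) + length (filter (¬? ∘ P?) xs)
length-filter-∁ P? [] = refl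
length-filter-∁ P? (x ∷ xs) with P? x
... | yes _ = cong suc (length-filter-∁ P? xs)
... | no _  = trans (cong suc (length-filter-∁ P? xs)) (sym (ℕ.+-suc _ _))

filter-filter-implied : {P Q : Pred A 0ℓ} (P? : Decidable P) (Q? : Decidable Q) →
  (∀ {x} → P x → Q x) → (xs : List A) → filter P? (filter Q? xs) ≡ filter P? xs
filter-filter-implied P? Q? P⇒Q [] = refl
filter-filter-implied P? Q? P⇒Q (x ∷ xs) with Q? x
... | no ¬q = trans (filter-filter-implied P? Q? P⇒Q xs) (sym (filter-reject P? (¬q ∘ P⇒Q)))
... | yes _ with P? x
...   | yes _ = cong (x ∷_) (filter-filter-implied P? Q? P⇒Q xs)
...   | no _  = filter-filter-implied P? Q? P⇒Q xs

module _ {_∼_ : A → A → Set} (_∼?_ : ∀ x y → Dec (x ∼ y))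
         (∼-refl : ∀ {x} → x ∼ x) (∼-sym : ∀ {x y} → x ∼ y → y ∼ x)
         (∼-trans : ∀ {x y z} → x ∼ y → y ∼ z → x ∼ z) (d : ℕ) where

  -- One class is removed at a time. The remaining classes are disjoint from it and keep their
  -- lengths, so the hypothesis passes to the rest.
  ∣-length-if-∣-classes : (xs : List A) → (∀ {x} → x ∈ xs → d ∣ length (filter (x ∼?_) xs)) → d ∣ length xs
  ∣-length-if-∣-classes xs = go xs (<-wellFounded (length xs))
    where
    go : ∀ xs → Acc _<_ (length xs) → (∀ {x} → x ∈ xs → d ∣ length (filter (x ∼?_) xs)) → d ∣ length xs
    go [] _ _ = d ∣0
    go xs@(x ∷ xs′) (acc rec) h = subst (d ∣_) (sym (length-filter-∁ (x ∼?_) xs))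
      (∣m∣n⇒∣m+n (h (here refl)) (go rest (rec shorter) h′))
      where
      rest = filter (¬? ∘ (x ∼?_)) xs
      shorter : length rest < length xs
      shorter rewrite filter-reject (¬? ∘ (x ∼?_)) {x} {xs′} (λ ¬x∼x → ¬x∼x ∼-refl) = s≤s (length-filter _ xs′)
      h′ : ∀ {y} → y ∈ rest → d ∣ length (filter (y ∼?_) rest)
      h′ {y} y∈ with y∈xs , x≁y ← ∈-filter⁻ (¬? ∘ (x ∼?_)) y∈ = subst (λ l → d ∣ length l)
        (sym (filter-filter-implied (y ∼?_) (¬? ∘ (x ∼?_)) (λ y∼z x∼z → x≁y (∼-trans x∼z (∼-sym y∼z))) xs)) (h y∈xs)

module _ (_≟_ : DecidableEquality B) (f : A → B) (c : ℕ) where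

  length-if-fibres : (ys : List B) → Unique ys → (xs : List A) → (∀ {x} → x ∈ xs → f x ∈ ys) →
    (∀ {y} → y ∈ ys → length (filter (λ x → f x ≟ y) xs) ≡ c) → length xs ≡ length ys * c
  length-if-fibres [] _ [] _ _ = refl
  length-if-fibres [] _ (x ∷ xs) f∈ _ = case f∈ (here refl) of λ ()
  length-if-fibres (y ∷ ys) (y∉ys ∷ ys!) xs f∈ fib = trans (length-filter-∁ (λ x → f x ≟ y) xs)
    (cong₂ _+_ (fib (here refl)) (length-if-fibres ys ys! rest f∈′ fib′))
    where
    rest = filter (λ x → ¬? (f x ≟ y)) xs
    f∈′ : ∀ {x} → x ∈ rest → f x ∈ ys
    f∈′ x∈ with x∈xs , fx≢y ← ∈-filter⁻ (λ x → ¬? (f x ≟ y)) x∈ with f∈ x∈xs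
    ... | here fx≡y = contradiction fx≡y fx≢y
    ... | there q = q
    fib′ : ∀ {z} → z ∈ ys → length (filter (λ x → f x ≟ z) rest) ≡ c
    fib′ {z} z∈ = trans (cong length (filter-filter-implied (λ x → f x ≟ z) (λ x → ¬? (f x ≟ y))
      (λ { fx≡z refl → Allₚ.All¬⇒¬Any y∉ys (subst (_∈ ys) (sym fx≡z) z∈) }) xs)) (fib (there z∈))

-- Prime powers and binomial coefficients

module _ {p : ℕ} (pr : Prime p) where

  private instance
    p≢0 : NonZero p
    p≢0 = prime⇒nonZero pr

  -- Euclid's lemma is applied to one factor p at a time: the quotient left by `p ^ r` has to absorb
  -- the next one.
  prime^∣-cancelˡ : ∀ r {m n} → p ∤ m → p ^ r ∣ m * n → p ^ r ∣ n
  prime^∣-cancelˡ zero _ _ = 1∣ _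
  prime^∣-cancelˡ (suc r) {m} {n} p∤m pʳ⁺¹∣mn
    with divides c refl ← prime^∣-cancelˡ r p∤m (∣-trans (n∣m*n p) pʳ⁺¹∣mn)
    with euclidsLemma m c pr (*-cancelʳ-∣ (p ^ r) ⦃ ℕ.m^n≢0 p r ⦄ (subst (p * p ^ r ∣_) (sym (ℕ.*-assoc m c (p ^ r))) pʳ⁺¹∣mn))
  ... | inj₁ p∣m = contradiction p∣m p∤m
  ... | inj₂ p∣c = *-monoˡ-∣ (p ^ r) p∣c

  ∣prime^⇒prime^ : ∀ r {d} → d ∣ p ^ r → ∃[ s ] d ≡ p ^ s
  ∣prime^⇒prime^ zero d∣1 = 0 , ∣1⇒≡1 d∣1
  ∣prime^⇒prime^ (suc r) {d} (divides c eq) with euclidsLemma c d pr (subst (p ∣_) eq (m∣m*n (p ^ r)))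
  ... | inj₂ (divides d′ refl) = case ∣prime^⇒prime^ r (divides c (ℕ.*-cancelˡ-≡ _ _ p (trans eq (trans (sym (ℕ.*-assoc c d′ p)) (ℕ.*-comm (c * d′) p))))) of
    λ { (s , refl) → suc s , ℕ.*-comm (p ^ s) p }
  ... | inj₁ (divides c′ refl) = ∣prime^⇒prime^ r (divides c′ (ℕ.*-cancelˡ-≡ _ _ p
    (trans eq (trans (cong (_* d) (ℕ.*-comm c′ p)) (ℕ.*-assoc p c′ d)))))

  1<prime : 1 < p
  1<prime = nonTrivial⇒n>1 p ⦃ prime⇒nonTrivial pr ⦄

  1<prime^[1+a] : ∀ a → 1 < p ^ suc a
  1<prime^[1+a] a = ℕ.<-≤-trans 1<prime (ℕ.m≤m*n p (p ^ a) ⦃ ℕ.m^n≢0 p a ⦄)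

  prime∤1 : p ∤ 1
  prime∤1 p∣1 = ℕ.<⇒≢ 1<prime (sym (∣1⇒≡1 p∣1))

  prime^-∣ : ∀ {r s} → r ≤ s → p ^ r ∣ p ^ s
  prime^-∣ {r} {s} r≤s = divides (p ^ (s ∸ r)) (trans (cong (p ^_) (sym (ℕ.m∸n+n≡m r≤s))) (ℕ.^-distribˡ-+-* p (s ∸ r) r))

-- The absorption identity, by induction through Pascal's rule. It relates neighbouring binomial
-- coefficients without division.
[k+1]*[n+1]C[k+1]≡[n+1]*nCk : ∀ n k → suc k * (suc n C suc k) ≡ suc n * (n C k)
[k+1]*[n+1]C[k+1]≡[n+1]*nCk n zero = trans (ℕ.*-identityˡ (suc n C 1)) (trans (nC1≡n (suc n)) (sym (ℕ.*-identityʳ (suc n))))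
[k+1]*[n+1]C[k+1]≡[n+1]*nCk zero (suc k) = ℕ.*-zeroʳ (suc (suc k))
[k+1]*[n+1]C[k+1]≡[n+1]*nCk (suc n) (suc k) = begin
  suc (suc k) * (suc (suc n) C suc (suc k))
    ≡⟨ cong (suc (suc k) *_) (nCk+nC[k+1]≡[n+1]C[k+1] (suc n) (suc k)) ⟨
  suc (suc k) * (b + suc n C suc (suc k))
    ≡⟨ ℕ.*-distribˡ-+ (suc (suc k)) b _ ⟩
  (b + suc k * b) + suc (suc k) * (suc n C suc (suc k))
    ≡⟨ cong₂ (λ u v → (b + u) + v) ([k+1]*[n+1]C[k+1]≡[n+1]*nCk n k) ([k+1]*[n+1]C[k+1]≡[n+1]*nCk n (suc k)) ⟩
  (b + suc n * (n C k)) + suc n * (n C suc k)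
    ≡⟨ ℕ.+-assoc b _ _ ⟩
  b + (suc n * (n C k) + suc n * (n C suc k))
    ≡⟨ cong (b +_) (ℕ.*-distribˡ-+ (suc n) (n C k) _) ⟨
  b + suc n * (n C k + n C suc k)
    ≡⟨ cong (λ u → b + suc n * u) (nCk+nC[k+1]≡[n+1]C[k+1] n k) ⟩
  suc (suc n) * b ∎
  where
  open ≡-Reasoning
  b = suc n C suc k

module _ {p : ℕ} (pr : Prime p) (r t : ℕ) (p∤t : p ∤ t) where
  private
    instance
      p≢0 : NonZero p
      p≢0 = prime⇒nonZero pr

  -- By absorption `p ^ r` divides the product of the binomial coefficient and k + 1. If p missed
  -- the coefficient, `p ^ r` would divide k + 1, which is too small. The case r = t = 1 serves the
  -- Frobenius map.
  prime∣[pʳt]Ck : ∀ {N} → suc N ≡ p ^ r * t → ∀ k → suc k < p ^ r → p ∣ suc N C suc k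
  prime∣[pʳt]Ck {N} eq k k<pʳ with p ∣? suc N C suc k
  ... | yes p∣ = p∣
  ... | no p∤ = contradiction
    (∣⇒≤ (prime^∣-cancelˡ pr r p∤ (divides (t * (N C k)) (begin
      (suc N C suc k) * suc k   ≡⟨ ℕ.*-comm (suc N C suc k) (suc k) ⟩
      suc k * (suc N C suc k)   ≡⟨ [k+1]*[n+1]C[k+1]≡[n+1]*nCk N k ⟩
      suc N * (N C k)           ≡⟨ cong (_* (N C k)) eq ⟩
      p ^ r * t * (N C k)       ≡⟨ ℕ.*-assoc (p ^ r) t _ ⟩
      p ^ r * (t * (N C k))     ≡⟨ ℕ.*-comm (p ^ r) _ ⟩
      t * (N C k) * p ^ r       ∎))))
    (ℕ.<⇒≱ k<pʳ)
    where open ≡-Reasoning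

  private
    -- Modulo p, Pascal's rule makes consecutive coefficients of this row negatives of each other,
    -- and the row starts with 1.
    prime∤[pʳt-1]Ck : ∀ {N} → suc N ≡ p ^ r * t → ∀ k → k < p ^ r → p ∤ N C k
    prime∤[pʳt-1]Ck eq zero _ = prime∤1 pr
    prime∤[pʳt-1]Ck {N} eq (suc k) k<pʳ p∣ = prime∤[pʳt-1]Ck eq k (ℕ.<-trans (ℕ.n<1+n k) k<pʳ)
      (∣m+n∣m⇒∣n (subst (p ∣_) (trans (sym (nCk+nC[k+1]≡[n+1]C[k+1] N k)) (ℕ.+-comm (N C k) _)) (prime∣[pʳt]Ck eq k k<pʳ)) p∣)

  -- Absorption with k + 1 = pʳ cancels to C(pʳt, pʳ) = t C(pʳt - 1, pʳ - 1), a product of two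
  -- factors prime to p.
  prime∤[pʳt]C[pʳ] : p ∤ (p ^ r * t) C (p ^ r)
  prime∤[pʳt]C[pʳ] = aux _ _ refl refl
    where
    open ≡-Reasoning
    -- Both numbers are generalised so that they can be matched as successors; the zero cases
    -- contradict pʳ ≠ 0 and p ∤ t.
    aux : ∀ n q → n ≡ p ^ r * t → q ≡ p ^ r → p ∤ n C q
    aux _ zero _ eq′ _ = ≢-nonZero⁻¹ (p ^ r) ⦃ ℕ.m^n≢0 p r ⦄ (sym eq′)
    aux zero (suc k) eq _ _ = [ ≢-nonZero⁻¹ (p ^ r) ⦃ ℕ.m^n≢0 p r ⦄ , (λ { refl → p∤t (p ∣0) }) ]′ (ℕ.m*n≡0⇒m≡0∨n≡0 (p ^ r) (sym eq))
    aux (suc N) (suc k) eq eq′ p∣ = [ p∤t , prime∤[pʳt-1]Ck eq k (ℕ.≤-reflexive eq′) ]′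
      (euclidsLemma t (N C k) pr (subst (p ∣_) eq₂ p∣))
      where
      eq₂ : suc N C suc k ≡ t * (N C k)
      eq₂ = ℕ.*-cancelˡ-≡ _ _ (suc k) (begin
        suc k * (suc N C suc k) ≡⟨ [k+1]*[n+1]C[k+1]≡[n+1]*nCk N k ⟩
        suc N * (N C k)         ≡⟨ cong (_* (N C k)) (trans eq (cong (_* t) (sym eq′))) ⟩
        suc k * t * (N C k)     ≡⟨ ℕ.*-assoc (suc k) t _ ⟩
        suc k * (t * (N C k))   ∎)

lookup-injective : {xs : List A} → Unique xs → ∀ i j → List.lookup xs i ≡ List.lookup xs j → i ≡ j
lookup-injective (_ ∷ _)     zero    zero    _  = refl
lookup-injective (x∉xs ∷ _)  zero    (suc j) eq = contradiction eq (All.lookup x∉xs (∈-lookup j))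
lookup-injective (x∉xs ∷ _)  (suc i) zero    eq = contradiction (sym eq) (All.lookup x∉xs (∈-lookup i))
lookup-injective (_ ∷ xs!)   (suc i) (suc j) eq = cong suc (lookup-injective xs! i j eq)

-- Finite group actions

module FiniteGroupAction {G : Set} {_∙_ : G → G → G} {ε : G} {_⁻¹ : G → G}
                         (isGroup : IsGroup _≡_ _∙_ ε _⁻¹) where

  group : Group 0ℓ 0ℓ
  group = record { isGroup = isGroup }

  open IsGroup isGroup using (inverseˡ)
  open GroupProperties group using (∙-cancelˡ)

  -- Listing the elements without repetition makes the order a length and a stabiliser a `filter`.
  record FiniteSubgroup : Set where
    field
      elems     : List G
      unique    : Unique elems
      ε-mem     : ε ∈ elems
      ∙-closed  : ∀ {g h} → g ∈ elems → h ∈ elems → g ∙ h ∈ elems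
      ⁻¹-closed : ∀ {g} → g ∈ elems → g ⁻¹ ∈ elems

    order : ℕ
    order = length elems

  open FiniteSubgroup

  module _ {Ω : Set} (_≟_ : DecidableEquality Ω) (_⋆_ : G → Ω → Ω)
           (⋆-ε : ∀ x → ε ⋆ x ≡ x) (⋆-∙ : ∀ g h x → (g ∙ h) ⋆ x ≡ g ⋆ (h ⋆ x)) where

    ⋆-⁻¹ : ∀ {g x y} → g ⋆ x ≡ y → (g ⁻¹) ⋆ y ≡ x
    ⋆-⁻¹ {g} {x} refl = trans (sym (⋆-∙ (g ⁻¹) g x)) (trans (cong (_⋆ x) (inverseˡ g)) (⋆-ε x))

    stabiliser : FiniteSubgroup → Ω → FiniteSubgroup
    stabiliser H x = record
      { elems     = filter fixes? (elems H)
      ; unique    = Unique.filter⁺ fixes? (unique H)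
      ; ε-mem     = ∈-filter⁺ fixes? (ε-mem H) (⋆-ε x)
      ; ∙-closed  = λ {g} {h} g∈ h∈ →
          case (∈-filter⁻ fixes? {xs = elems H} g∈ , ∈-filter⁻ fixes? {xs = elems H} h∈) of λ { ((g∈H , gx) , (h∈H , hx)) →
            ∈-filter⁺ fixes? (∙-closed H g∈H h∈H) (trans (⋆-∙ g h x) (trans (cong (g ⋆_) hx) gx)) }
      ; ⁻¹-closed = λ g∈ → case ∈-filter⁻ fixes? {xs = elems H} g∈ of λ { (g∈H , gx) →
            ∈-filter⁺ fixes? (⁻¹-closed H g∈H) (⋆-⁻¹ gx) }
      }
      where
      fixes? : ∀ g → Dec (g ⋆ x ≡ x)
      fixes? g = (g ⋆ x) ≟ x

    module _ (H : FiniteSubgroup) where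

      _∼_ : Ω → Ω → Set
      x ∼ y = Any (λ h → h ⋆ x ≡ y) (elems H)

      _∼?_ : ∀ x y → Dec (x ∼ y)
      x ∼? y = any? (λ h → (h ⋆ x) ≟ y) (elems H)

      ∼-refl : ∀ {x} → x ∼ x
      ∼-refl = lose (ε-mem H) (⋆-ε _)

      ∼-sym : ∀ {x y} → x ∼ y → y ∼ x
      ∼-sym x∼y with h , h∈ , hx≡y ← find x∼y = lose (⁻¹-closed H h∈) (⋆-⁻¹ hx≡y)

      ∼-trans : ∀ {x y z} → x ∼ y → y ∼ z → x ∼ z
      ∼-trans {x} x∼y y∼z with h , h∈ , hx≡y ← find x∼y | k , k∈ , ky≡z ← find y∼z =
        lose (∙-closed H k∈ h∈) (trans (⋆-∙ k h x) (trans (cong (k ⋆_) hx≡y) ky≡z))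

      module _ {xs : List Ω} (xs! : Unique xs) (closed : ∀ {h x} → h ∈ elems H → x ∈ xs → h ⋆ x ∈ xs) where

        orbit : Ω → List Ω
        orbit x = filter (x ∼?_) xs

        -- The group elements taking x to y form a coset of the stabiliser; multiplication by one of
        -- them, k, and by `k ⁻¹` gives the two inequalities.
        orbit-stabiliser : ∀ {x} → x ∈ xs → order H ≡ length (orbit x) * order (stabiliser H x)
        orbit-stabiliser {x} x∈ = length-if-fibres _≟_ (_⋆ x) (order (stabiliser H x)) (orbit x)
          (Unique.filter⁺ (x ∼?_) xs!) (elems H)
          (λ h∈ → ∈-filter⁺ (x ∼?_) (closed h∈ x∈) (lose h∈ refl)) fibre
          where
          fibre : ∀ {y} → y ∈ orbit x → length (filter (λ h → (h ⋆ x) ≟ y) (elems H)) ≡ order (stabiliser H x)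
          fibre {y} y∈ with k , k∈ , kx≡y ← find (proj₂ (∈-filter⁻ (x ∼?_) {xs = xs} y∈)) = ℕ.≤-antisym
            (length-mono-injective (∙-cancelˡ (k ⁻¹) _ _) (Unique.filter⁺ (λ h → (h ⋆ x) ≟ y) (unique H)) λ {h} h∈ →
              case ∈-filter⁻ (λ h → (h ⋆ x) ≟ y) h∈ of λ { (h∈H , hx≡y) →
                ∈-filter⁺ (λ h → (h ⋆ x) ≟ x) (∙-closed H (⁻¹-closed H k∈) h∈H)
                  (trans (⋆-∙ (k ⁻¹) h x) (trans (cong ((k ⁻¹) ⋆_) hx≡y) (⋆-⁻¹ kx≡y))) })
            (length-mono-injective (∙-cancelˡ k _ _) (unique (stabiliser H x)) λ {h} h∈ →
              case ∈-filter⁻ (λ h → (h ⋆ x) ≟ x) h∈ of λ { (h∈H , hx≡x) →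
                ∈-filter⁺ (λ h → (h ⋆ x) ≟ y) (∙-closed H k∈ h∈H)
                  (trans (⋆-∙ k h x) (trans (cong (k ⋆_) hx≡x) kx≡y)) })

        -- A common divisor of all orbit lengths divides their sum. This is used with d = p on
        -- subsets and with d a higher power of p on points.
        ∃-orbit-∤ : ∀ {d} → d ∤ length xs → ∃[ x ] x ∈ xs × d ∤ length (orbit x)
        ∃-orbit-∤ {d} d∤ with all? (λ x → d ∣? length (orbit x)) xs
        ... | yes d∣ = contradiction (∣-length-if-∣-classes _∼?_ ∼-refl ∼-sym ∼-trans d xs (All.lookup d∣)) d∤
        ... | no ¬d∣ = find (Allₚ.¬All⇒Any¬ (λ x → d ∣? length (orbit x)) xs ¬d∣)

  order>0 : ∀ H → 0 < order H
  order>0 H = ∈-length (ε-mem H)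

-- Subsets of a finite set as characteristic vectors

members : ∀ {n} → Vec Bool n → List (Fin n)
members []          = []
members (true ∷ T)  = zero ∷ map suc (members T)
members (false ∷ T) = map suc (members T)

∈-members⁺ : ∀ {n} (T : Vec Bool n) {i} → Vec.lookup T i ≡ true → i ∈ members T
∈-members⁺ (true ∷ T)  {zero}  _  = here refl
∈-members⁺ (true ∷ T)  {suc i} eq = there (∈-map⁺ suc (∈-members⁺ T eq))
∈-members⁺ (false ∷ T) {suc i} eq = ∈-map⁺ suc (∈-members⁺ T eq)

∈-members⁻ : ∀ {n} (T : Vec Bool n) {i} → i ∈ members T → Vec.lookup T i ≡ true
∈-members⁻ (true ∷ T)  (here refl) = refl
∈-members⁻ (true ∷ T)  (there i∈) with _ , j∈ , refl ← ∈-map⁻ suc i∈ = ∈-members⁻ T j∈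
∈-members⁻ (false ∷ T) i∈ with _ , j∈ , refl ← ∈-map⁻ suc i∈ = ∈-members⁻ T j∈

members! : ∀ {n} (T : Vec Bool n) → Unique (members T)
members! []          = []
members! (true ∷ T)  = All.tabulate (λ { i∈ refl → case ∈-map⁻ suc i∈ of λ () }) ∷ Unique.map⁺ suc-injective (members! T)
members! (false ∷ T) = Unique.map⁺ suc-injective (members! T)

-- The recursion follows Pascal's rule, so that the length is a binomial coefficient.
subsets : ∀ n → ℕ → List (Vec Bool n)
subsets zero    zero    = [] ∷ []
subsets zero    (suc k) = []
subsets (suc n) zero    = map (false ∷_) (subsets n zero)
subsets (suc n) (suc k) = map (true ∷_) (subsets n k) ++ map (false ∷_) (subsets n (suc k))

length-subsets : ∀ n k → length (subsets n k) ≡ n C k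
length-subsets zero    zero    = refl
length-subsets zero    (suc k) = refl
length-subsets (suc n) zero    = trans (length-map (false ∷_) (subsets n zero)) (length-subsets n zero)
length-subsets (suc n) (suc k) = begin
  length (map (true ∷_) (subsets n k) ++ map (false ∷_) (subsets n (suc k)))
    ≡⟨ length-++ (map (true ∷_) (subsets n k)) ⟩
  length (map (true ∷_) (subsets n k)) + length (map (false ∷_) (subsets n (suc k)))
    ≡⟨ cong₂ _+_ (length-map (true ∷_) (subsets n k)) (length-map (false ∷_) (subsets n (suc k))) ⟩
  length (subsets n k) + length (subsets n (suc k))
    ≡⟨ cong₂ _+_ (length-subsets n k) (length-subsets n (suc k)) ⟩
  n C k + n C suc k
    ≡⟨ nCk+nC[k+1]≡[n+1]C[k+1] n k ⟩
  suc n C suc k ∎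
  where open ≡-Reasoning

subsets! : ∀ n k → Unique (subsets n k)
subsets! zero    zero    = [] ∷ []
subsets! zero    (suc k) = []
subsets! (suc n) zero    = Unique.map⁺ ∷-injectiveʳ (subsets! n zero)
subsets! (suc n) (suc k) = Unique.++⁺ (Unique.map⁺ ∷-injectiveʳ (subsets! n k)) (Unique.map⁺ ∷-injectiveʳ (subsets! n (suc k)))
  λ (T∈₁ , T∈₂) → case (∈-map⁻ (true ∷_) T∈₁ , ∈-map⁻ (false ∷_) T∈₂) of λ { ((_ , _ , refl) , (_ , _ , ())) }

∈-subsets⁺ : ∀ {n} (T : Vec Bool n) → T ∈ subsets n (length (members T))
∈-subsets⁺ [] = here refl
∈-subsets⁺ (true ∷ T) rewrite length-map Fin.suc (members T) = ∈-++⁺ˡ (∈-map⁺ (true ∷_) (∈-subsets⁺ T))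
∈-subsets⁺ {suc n} (false ∷ T) rewrite length-map Fin.suc (members T) with length (members T) | ∈-subsets⁺ T
... | zero  | T∈ = ∈-map⁺ (false ∷_) T∈
... | suc k | T∈ = ∈-++⁺ʳ (map (true ∷_) (subsets n k)) (∈-map⁺ (false ∷_) T∈)

∈-subsets⁻ : ∀ {n} k {T : Vec Bool n} → T ∈ subsets n k → length (members T) ≡ k
∈-subsets⁻ {zero}  zero    (here refl) = refl
∈-subsets⁻ {suc n} zero    T∈ with T , T∈′ , refl ← ∈-map⁻ (false ∷_) T∈ =
  trans (length-map suc (members T)) (∈-subsets⁻ zero T∈′)
∈-subsets⁻ {suc n} (suc k) T∈ with ∈-++⁻ (map (true ∷_) (subsets n k)) T∈
... | inj₁ T∈₁ with T , T∈′ , refl ← ∈-map⁻ (true ∷_) T∈₁ =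
  cong suc (trans (length-map suc (members T)) (∈-subsets⁻ k T∈′))
... | inj₂ T∈₂ with T , T∈′ , refl ← ∈-map⁻ (false ∷_) T∈₂ =
  trans (length-map suc (members T)) (∈-subsets⁻ (suc k) T∈′)

-- Sylow's theorem by Wielandt's argument: the number of pʳ-subsets of a group of order pʳt is prime to p,
-- so some pʳ-subset lies in an orbit of size prime to p; its stabiliser has order pʳ.

module _ {N : ℕ} {_∙_ : Fin N → Fin N → Fin N} {ε : Fin N} {_⁻¹ : Fin N → Fin N}
         (isGroup : IsGroup _≡_ _∙_ ε _⁻¹) where

  open FiniteGroupAction isGroup
  open FiniteSubgroup
  open IsGroup isGroup using (assoc; identityˡ; inverseˡ)
  open GroupProperties group using (∙-cancelˡ; ∙-cancelʳ; ε⁻¹≈ε; ⁻¹-anti-homo-∙; \\-leftDividesʳ)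

  whole : FiniteSubgroup
  whole = record { elems = allFin N ; unique = Unique.allFin⁺ N ; ε-mem = ∈-allFin ε
                 ; ∙-closed = λ _ _ → ∈-allFin _ ; ⁻¹-closed = λ _ → ∈-allFin _ }

  -- The left translate gT: x belongs to it when g⁻¹x belongs to T.
  translate : Fin N → Vec Bool N → Vec Bool N
  translate g T = Vec.tabulate (λ x → Vec.lookup T ((g ⁻¹) ∙ x))

  translate-ε : ∀ T → translate ε T ≡ T
  translate-ε T = trans (tabulate-cong λ x → cong (Vec.lookup T) (trans (cong (_∙ x) ε⁻¹≈ε) (identityˡ x))) (tabulate∘lookup T)

  translate-∙ : ∀ g h T → translate (g ∙ h) T ≡ translate g (translate h T)
  translate-∙ g h T = tabulate-cong λ x → trans
    (cong (Vec.lookup T) (trans (cong (_∙ x) (⁻¹-anti-homo-∙ g h)) (assoc (h ⁻¹) (g ⁻¹) x)))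
    (sym (lookup∘tabulate _ ((g ⁻¹) ∙ x)))

  ∈-translate : ∀ g T {x} → x ∈ members T → g ∙ x ∈ members (translate g T)
  ∈-translate g T {x} x∈ = ∈-members⁺ (translate g T) (trans (lookup∘tabulate _ (g ∙ x))
    (trans (cong (Vec.lookup T) (\\-leftDividesʳ g x)) (∈-members⁻ T x∈)))

  length-translate-≥ : ∀ g T → length (members T) ≤ length (members (translate g T))
  length-translate-≥ g T = length-mono-injective (∙-cancelˡ g _ _) (members! T) (∈-translate g T)

  -- Translation does not shrink a set, and neither does translating back.
  length-translate : ∀ g T → length (members (translate g T)) ≡ length (members T)
  length-translate g T = ℕ.≤-antisym (subst (λ T′ → length (members (translate g T)) ≤ length (members T′))
      (trans (sym (translate-∙ (g ⁻¹) g T)) (trans (cong (λ h → translate h T) (inverseˡ g)) (translate-ε T)))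
      (length-translate-≥ (g ⁻¹) (translate g T)))
    (length-translate-≥ g T)

  sylow : ∀ {p} → Prime p → ∀ r t → p ∤ t → N ≡ p ^ r * t → Σ FiniteSubgroup λ P → order P ≡ p ^ r
  sylow {p} pr r t p∤t N≡ = P , ℕ.≤-antisym order≤ order≥
    where
    closed : ∀ {h T} → h ∈ allFin N → T ∈ subsets N (p ^ r) → translate h T ∈ subsets N (p ^ r)
    closed {h} {T} _ T∈ = subst (λ k → translate h T ∈ subsets N k)
      (trans (length-translate h T) (∈-subsets⁻ (p ^ r) T∈)) (∈-subsets⁺ (translate h T))
    p∤ : p ∤ length (subsets N (p ^ r))
    p∤ p∣ = prime∤[pʳt]C[pʳ] pr r t p∤t (subst (p ∣_) (trans (length-subsets N (p ^ r)) (cong (_C (p ^ r)) N≡)) p∣)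
    chosen = ∃-orbit-∤ (≡-dec Bool._≟_) translate translate-ε translate-∙ whole (subsets! N (p ^ r)) closed p∤
    T = proj₁ chosen
    T∈ = proj₁ (proj₂ chosen)
    P = stabiliser (≡-dec Bool._≟_) translate translate-ε translate-∙ whole T
    -- The orbit length times the order of P is pʳt, and the orbit length is prime to p, so pʳ
    -- divides the order of P.
    order≥ : p ^ r ≤ order P
    order≥ = ∣⇒≤ ⦃ >-nonZero (order>0 P) ⦄ (prime^∣-cancelˡ pr r (proj₂ (proj₂ chosen)) (divides t (trans
      (sym (orbit-stabiliser (≡-dec Bool._≟_) translate translate-ε translate-∙ whole (subsets! N (p ^ r)) closed T∈))
      (trans (length-tabulate id) (trans N≡ (ℕ.*-comm (p ^ r) t))))))
    -- P maps T into itself, so for a fixed x in T the injection h ↦ hx embeds P into T, which has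
    -- pʳ elements.
    order≤ : order P ≤ p ^ r
    order≤ with members T in eq | ∈-subsets⁻ (p ^ r) T∈
    ... | [] | 0≡pʳ = contradiction (sym 0≡pʳ) (≢-nonZero⁻¹ (p ^ r) ⦃ ℕ.m^n≢0 p r ⦃ prime⇒nonZero pr ⦄ ⦄)
    ... | x ∷ xs | length≡pʳ = subst (order P ≤_) (trans (cong length eq) length≡pʳ)
      (length-mono-injective (∙-cancelʳ x _ _) (unique P) λ {h} h∈ →
        subst (λ T′ → h ∙ x ∈ members T′) (proj₂ (∈-filter⁻ (λ g → ≡-dec Bool._≟_ (translate g T) T) {xs = allFin N} h∈))
          (∈-translate h T (subst (x ∈_) (sym eq) (here refl))))

-- The upper bound for a group of order n² with trivially meeting stabilisers

length-concat-≥ : {A : Set} (c : ℕ) (xss : List (List A)) → All (λ xs → c ≤ length xs) xss → length xss * c ≤ length (concat xss)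
length-concat-≥ c [] [] = z≤n
length-concat-≥ c (xs ∷ xss) (c≤ ∷ cs≤) = ℕ.≤-trans (ℕ.+-mono-≤ c≤ (length-concat-≥ c xss cs≤)) (ℕ.≤-reflexive (sym (length-++ xs)))

-- Since (M + 2)(M - 1) = M² + (M - 2), a value k ≥ M + 2 would push the left side past M² as soon
-- as M ≥ 2.
k[M-1]<M²⇒k≤M+1 : ∀ k M → 1 < M → suc (k * (M ∸ 1)) ≤ M * M → k ≤ suc M
k[M-1]<M²⇒k≤M+1 k (suc zero) (s≤s ()) _
k[M-1]<M²⇒k≤M+1 k (suc (suc c)) _ le = ℕ.≮⇒≥ λ M+1<k → ℕ.<⇒≱ (begin-strict
    M * M                   <⟨ ℕ.n<1+n (M * M) ⟩
    1 + M * M               ≤⟨ ℕ.m≤n+m (1 + M * M) c ⟩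
    c + (1 + M * M)         ≡⟨ solve 1 (λ c → c :+ (con 1 :+ (con 2 :+ c) :* (con 2 :+ c)) := con 1 :+ (con 4 :+ c) :* (con 1 :+ c)) refl c ⟩
    1 + (4 + c) * (1 + c)   ≤⟨ s≤s (ℕ.*-monoˡ-≤ (1 + c) M+1<k) ⟩
    1 + k * (1 + c)         ∎) le
  where
  M = suc (suc c)
  open ℕ.≤-Reasoning
  open +-*-Solver

module _ {k n : ℕ} {_∙_ : Fin (n * n) → Fin (n * n) → Fin (n * n)} {ε : Fin (n * n)} {_⁻¹ : Fin (n * n) → Fin (n * n)}
         (isGroup : IsGroup _≡_ _∙_ ε _⁻¹) (act : Fin k → Fin (n * n) → Fin n → Fin n)
         (act-ε : ∀ i x → act i ε x ≡ x) (act-∙ : ∀ i g h x → act i (g ∙ h) x ≡ act i g (act i h x))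
         (act-free : ∀ {i j} → i ≢ j → ∀ {g x y} → act i g x ≡ x → act j g y ≡ y → g ≡ ε) where

  open FiniteGroupAction isGroup
  open FiniteSubgroup

  -- The `suc` counts the identity. The nonidentity parts `Q* i` are pairwise disjoint by
  -- `act-free`, wherever the points `x i` lie.
  stabilisers-packed : ∀ P M (x : Fin k → Fin n) →
    (∀ i → M ≤ order (stabiliser Fin._≟_ (act i) (act-ε i) (act-∙ i) P (x i))) → suc (k * (M ∸ 1)) ≤ order P
  stabilisers-packed P M x large = begin
    suc (k * (M ∸ 1))                          ≡⟨ cong (λ l → suc (l * (M ∸ 1))) (trans (length-map Q* (allFin k)) (length-tabulate {n = k} id)) ⟨
    suc (length (map Q* (allFin k)) * (M ∸ 1)) ≤⟨ s≤s (length-concat-≥ (M ∸ 1) (map Q* (allFin k)) (Allₚ.map⁺ (All.tabulate λ {i} _ → length-Q* i))) ⟩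
    suc (length (concat (map Q* (allFin k))))  ≤⟨ length-mono-⊆ unique* ⊆P ⟩
    order P                                    ∎
    where
    open ℕ.≤-Reasoning
    Q : Fin k → FiniteSubgroup
    Q i = stabiliser Fin._≟_ (act i) (act-ε i) (act-∙ i) P (x i)
    Q* : Fin k → List (Fin (n * n))
    Q* i = filter (λ g → ¬? (g Fin.≟ ε)) (elems (Q i))
    length-Q* : ∀ i → M ∸ 1 ≤ length (Q* i)
    length-Q* i = ℕ.∸-monoˡ-≤ 1 (ℕ.≤-trans (large i) (length-mono-⊆ {ys = ε ∷ Q* i} (unique (Q i)) λ {g} g∈ →
      case g Fin.≟ ε of λ { (yes g≡ε) → here g≡ε ; (no g≢ε) → there (∈-filter⁺ (λ g → ¬? (g Fin.≟ ε)) g∈ g≢ε) }))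
    Q*⊆P : ∀ i {g} → g ∈ Q* i → g ∈ elems P × act i g (x i) ≡ x i × g ≢ ε
    Q*⊆P i g∈ with g∈Q , g≢ε ← ∈-filter⁻ (λ g → ¬? (g Fin.≟ ε)) {xs = elems (Q i)} g∈
              with g∈P , fix ← ∈-filter⁻ (λ g → act i g (x i) Fin.≟ x i) {xs = elems P} g∈Q = g∈P , fix , g≢ε
    unique* : Unique (ε ∷ concat (map Q* (allFin k)))
    unique* = All.tabulate (λ { g∈ refl → case ∈-concat⁻′ (map Q* (allFin k)) g∈ of λ (_ , g∈Q , Q∈) →
                case ∈-map⁻ Q* Q∈ of λ { (i , _ , refl) → proj₂ (proj₂ (Q*⊆P i g∈Q)) refl } })
            ∷ Unique.concat⁺ (Allₚ.map⁺ (All.tabulate λ {i} _ → Unique.filter⁺ (λ g → ¬? (g Fin.≟ ε)) (unique (Q i))))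
                (AllPairsₚ.map⁺ (AllPairs.map (λ {i} {j} i≢j {g} (g∈i , g∈j) →
                  case (Q*⊆P i g∈i , Q*⊆P j g∈j) of λ ((_ , fixᵢ , g≢ε) , (_ , fixⱼ , _)) → g≢ε (act-free i≢j fixᵢ fixⱼ))
                  (Unique.allFin⁺ k)))
    ⊆P : ε ∷ concat (map Q* (allFin k)) ⊆ elems P
    ⊆P (here refl) = ε-mem P
    ⊆P (there g∈) = case ∈-concat⁻′ (map Q* (allFin k)) g∈ of λ (_ , g∈Q , Q∈) →
      case ∈-map⁻ Q* Q∈ of λ { (i , _ , refl) → proj₁ (Q*⊆P i g∈Q) }

  module _ {p : ℕ} (pr : Prime p) (a : ℕ) (pᵃ∣n : p ^ a ∣ n) (pᵃ⁺¹∤n : p ^ suc a ∤ n) where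

    private
      c = _∣_.quotient pᵃ∣n

      p∤c : p ∤ c
      p∤c p∣c = pᵃ⁺¹∤n (subst (p ^ suc a ∣_) (sym (_∣_.equality pᵃ∣n)) (*-monoˡ-∣ (p ^ a) p∣c))

      n*n≡ : n * n ≡ p ^ (a + a) * (c * c)
      n*n≡ = begin
        n * n                       ≡⟨ cong₂ _*_ (_∣_.equality pᵃ∣n) (_∣_.equality pᵃ∣n) ⟩
        (c * p ^ a) * (c * p ^ a)   ≡⟨ solve 2 (λ x y → (x :* y) :* (x :* y) := (y :* y) :* (x :* x)) refl c (p ^ a) ⟩
        (p ^ a * p ^ a) * (c * c)   ≡⟨ cong (_* (c * c)) (ℕ.^-distribˡ-+-* p a a) ⟨
        p ^ (a + a) * (c * c)       ∎
        where
        open ≡-Reasoning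
        open +-*-Solver

      sylowSubgroup : Σ FiniteSubgroup λ P → order P ≡ p ^ (a + a)
      sylowSubgroup = sylow isGroup pr (a + a) (c * c) ([ p∤c , p∤c ]′ ∘ euclidsLemma c c pr) n*n≡

      P = proj₁ sylowSubgroup

    -- Some orbit of P has length not divisible by `p ^ suc a`, because n is not. That length
    -- divides the order of P, hence is a power of p, and so it is at most `p ^ a`.
    large-stabiliser : ∀ i → ∃[ x ] p ^ a ≤ order (stabiliser Fin._≟_ (act i) (act-ε i) (act-∙ i) P x)
    large-stabiliser i = x , ℕ.*-cancelˡ-≤ (p ^ a) ⦃ ℕ.m^n≢0 p a ⦃ prime⇒nonZero pr ⦄ ⦄ (begin
        p ^ a * p ^ a               ≡⟨ ℕ.^-distribˡ-+-* p a a ⟨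
        p ^ (a + a)                 ≡⟨ product ⟩
        orbitLength * order Q       ≡⟨ cong (_* order Q) (proj₂ power) ⟩
        p ^ b * order Q             ≤⟨ ℕ.*-monoˡ-≤ (order Q) (ℕ.^-monoʳ-≤ p ⦃ prime⇒nonZero pr ⦄ b≤a) ⟩
        p ^ a * order Q             ∎)
      where
      open ℕ.≤-Reasoning
      closed : ∀ {h x} → h ∈ elems P → x ∈ allFin n → act i h x ∈ allFin n
      closed _ _ = ∈-allFin _
      chosen = ∃-orbit-∤ Fin._≟_ (act i) (act-ε i) (act-∙ i) P (Unique.allFin⁺ n) closed
        {p ^ suc a} (pᵃ⁺¹∤n ∘ subst (p ^ suc a ∣_) (length-tabulate {n = n} id))
      x = proj₁ chosen
      Q = stabiliser Fin._≟_ (act i) (act-ε i) (act-∙ i) P x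
      orbitLength = length (orbit Fin._≟_ (act i) (act-ε i) (act-∙ i) P (Unique.allFin⁺ n) closed x)
      product : p ^ (a + a) ≡ orbitLength * order Q
      product = trans (sym (proj₂ sylowSubgroup)) (orbit-stabiliser Fin._≟_ (act i) (act-ε i) (act-∙ i) P (Unique.allFin⁺ n) closed (proj₁ (proj₂ chosen)))
      power = ∣prime^⇒prime^ pr (a + a) (divides (order Q) (trans product (ℕ.*-comm orbitLength (order Q))))
      b = proj₁ power
      b≤a : b ≤ a
      b≤a = ℕ.≮⇒≥ λ a<b → proj₂ (proj₂ chosen) (subst (p ^ suc a ∣_) (sym (proj₂ power)) (prime^-∣ pr a<b))

    coordinates≤pᵃ+1 : 1 < p ^ a → k ≤ suc (p ^ a)
    coordinates≤pᵃ+1 1<pᵃ = k[M-1]<M²⇒k≤M+1 k (p ^ a) 1<pᵃ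
      (ℕ.≤-trans (stabilisers-packed P (p ^ a) (proj₁ ∘ large-stabiliser) (proj₂ ∘ large-stabiliser))
        (ℕ.≤-reflexive (trans (proj₂ sylowSubgroup) (ℕ.^-distribˡ-+-* p a a))))

-- The group of a simply transitive array, carried over to codes of points

module _ {k n : ℕ} (A : OrthogonalArray k n) (simplyTransitive : IsSimplyTransitive A)
         {i₀ i₁ : Fin k} (i₀≢i₁ : i₀ ≢ i₁) (o : Fin n) where

  open OrthogonalArray A
  open AutotopySubgroup (proj₁ simplyTransitive)

  private
    transitive = proj₁ (proj₂ simplyTransitive)
    simple = proj₂ (proj₂ simplyTransitive)

    jointly-injective : ∀ {i j} → i ≢ j → ∀ {s t} → π i s ≡ π i t → π j s ≡ π j t → s ≡ t
    jointly-injective i≢j eqᵢ eqⱼ = proj₁ (orth _ _ i≢j) (cong₂ _,_ eqᵢ eqⱼ)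

    meet : ∀ {i j} → i ≢ j → ∀ x y → ∃[ s ] (π i s ≡ x × π j s ≡ y)
    meet i≢j x y with s , eq ← proj₂ (orth _ _ i≢j) (x , y) = s , ,-injective (eq refl)

    point : Fin (n * n) → S
    point g = proj₁ (meet i₀≢i₁ (proj₁ (remQuot n g)) (proj₂ (remQuot {n} n g)))

    code : S → Fin (n * n)
    code s = combine (π i₀ s) (π i₁ s)

    point-code : ∀ s → point (code s) ≡ s
    point-code s = let _ , eq₀ , eq₁ = meet i₀≢i₁ (proj₁ (remQuot n (code s))) (proj₂ (remQuot {n} n (code s))) in jointly-injective i₀≢i₁
      (trans eq₀ (cong proj₁ (remQuot-combine (π i₀ s) (π i₁ s)))) (trans eq₁ (cong proj₂ (remQuot-combine (π i₀ s) (π i₁ s))))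

    code-point : ∀ g → code (point g) ≡ g
    code-point g = let _ , eq₀ , eq₁ = meet i₀≢i₁ (proj₁ (remQuot n g)) (proj₂ (remQuot {n} n g)) in
      trans (cong₂ combine eq₀ eq₁) (combine-remQuot {n} n g)

    s₀ = point (combine o o)

    -- The member of the group taking the base point to `point g`. Naming members by codes replaces
    -- `_≈T_` by propositional equality on `Fin (n * n)`, which is decidable.
    σ : Fin (n * n) → Tuple A
    σ g = proj₁ (transitive s₀ (point g))

    σ-mem : ∀ g → Mem (σ g)
    σ-mem g = proj₁ (proj₂ (transitive s₀ (point g)))

    act : Fin k → Fin (n * n) → Fin n → Fin n
    act i g x = σ g i ⟨$⟩ʳ x

    π-point : ∀ i g → π i (point g) ≡ act i g (π i s₀)
    π-point i g = proj₂ (proj₂ (transitive s₀ (point g))) i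

    image : ∀ τ → Mem τ → S → S
    image τ m s = proj₁ (proj₁ (mem-aut τ m) s)

    π-image : ∀ τ (m : Mem τ) s i → π i (image τ m s) ≡ τ i ⟨$⟩ʳ π i s
    π-image τ m s = proj₂ (proj₁ (mem-aut τ m) s)

    encode : ∀ τ → Mem τ → Fin (n * n)
    encode τ m = code (image τ m s₀)

    -- Both tuples send `s₀` to the same point, and simplicity identifies them.
    act-encode : ∀ τ (m : Mem τ) i x → act i (encode τ m) x ≡ τ i ⟨$⟩ʳ x
    act-encode τ m = simple s₀ (point (encode τ m)) (σ (encode τ m)) τ (σ-mem _) m
      (λ i → π-point i (encode τ m)) (λ i → trans (cong (π i) (point-code _)) (π-image τ m s₀ i))

    -- A code is recovered from the image of `s₀`. Every group law below is thereby reduced to a law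
    -- for the actions.
    ext : ∀ {g h} → (∀ i x → act i g x ≡ act i h x) → g ≡ h
    ext {g} {h} eq = trans (sym (code-point g)) (trans (cong code (jointly-injective i₀≢i₁ (eq′ i₀) (eq′ i₁))) (code-point h))
      where
      eq′ : ∀ i → π i (point g) ≡ π i (point h)
      eq′ i = trans (π-point i g) (trans (eq i (π i s₀)) (sym (π-point i h)))

    -- `compT` applies its first argument first, so the factors are exchanged to obtain a left
    -- action.
    _∙_ : Fin (n * n) → Fin (n * n) → Fin (n * n)
    g ∙ h = encode (compT A (σ h) (σ g)) (mem-∘ _ _ (σ-mem h) (σ-mem g))

    ε : Fin (n * n)
    ε = encode (idT A) mem-id

    _⁻¹ : Fin (n * n) → Fin (n * n)
    g ⁻¹ = encode (invT A (σ g)) (mem-inv _ (σ-mem g))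

    act-∙ : ∀ i g h x → act i (g ∙ h) x ≡ act i g (act i h x)
    act-∙ i g h = act-encode _ _ i

    act-ε : ∀ i x → act i ε x ≡ x
    act-ε = act-encode _ _

    act-⁻¹ˡ : ∀ i g x → act i (g ⁻¹) (act i g x) ≡ x
    act-⁻¹ˡ i g x = trans (act-encode _ _ i _) (Permutation.inverseˡ (σ g i))

    act-⁻¹ʳ : ∀ i g x → act i g (act i (g ⁻¹) x) ≡ x
    act-⁻¹ʳ i g x = trans (cong (act i g) (act-encode _ _ i x)) (Permutation.inverseʳ (σ g i))

    isGroup : IsGroup _≡_ _∙_ ε _⁻¹
    isGroup = record
      { isMonoid = record
        { isSemigroup = record
          { isMagma = record { isEquivalence = isEquivalence ; ∙-cong = cong₂ _∙_ }
          ; assoc = λ g h l → ext λ i x → trans (act-∙ i (g ∙ h) l x) (trans (act-∙ i g h _)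
              (sym (trans (act-∙ i g (h ∙ l) x) (cong (act i g) (act-∙ i h l x))))) }
        ; identity = (λ g → ext λ i x → trans (act-∙ i ε g x) (act-ε i _))
                   , (λ g → ext λ i x → trans (act-∙ i g ε x) (cong (act i g) (act-ε i x))) }
      ; inverse = (λ g → ext λ i x → trans (act-∙ i (g ⁻¹) g x) (trans (act-⁻¹ˡ i g x) (sym (act-ε i x))))
                , (λ g → ext λ i x → trans (act-∙ i g (g ⁻¹) x) (trans (act-⁻¹ʳ i g x) (sym (act-ε i x))))
      ; ⁻¹-cong = cong _⁻¹ }

    -- Orthogonality supplies the point t with coordinates x and y. Two of the coordinates of its
    -- image are those of t, so t is fixed, as it is by the identity; simplicity concludes.
    act-free : ∀ {i j} → i ≢ j → ∀ {g x y} → act i g x ≡ x → act j g y ≡ y → g ≡ ε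
    act-free {i} {j} i≢j {g} {x} {y} fixᵢ fixⱼ with t , refl , refl ← meet i≢j x y =
      ext (λ l z → trans (simple t t (σ g) (idT A) (σ-mem g) mem-id sends (λ _ → refl) l z) (sym (act-ε l z)))
      where
      gt≡t : image (σ g) (σ-mem g) t ≡ t
      gt≡t = jointly-injective i≢j (trans (π-image _ _ t i) fixᵢ) (trans (π-image _ _ t j) fixⱼ)
      sends : Sends A (σ g) t t
      sends l = trans (cong (π l) (sym gt≡t)) (π-image _ _ t l)

  coordinates-bound : ∀ {p} a → IsPrimePowerFactor n p (suc a) → k ≤ suc (p ^ suc a)
  coordinates-bound a (pr , _ , pᵃ∣n , pᵃ⁺¹∤n) =
    coordinates≤pᵃ+1 isGroup act act-ε act-∙ act-free pr (suc a) pᵃ∣n pᵃ⁺¹∤n (1<prime^[1+a] pr a)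

-- A cyclic module over ℤ[T] with generator 1v is a quotient of ℤ[T], hence a commutative ring.

module CyclicModule {V : Set} {_⊕_ : V → V → V} {0v : V} {⊖_ : V → V} (isAbelianGroup : IsAbelianGroup _≡_ _⊕_ 0v ⊖_)
                    {T : V → V} (T-⊕ : ∀ u v → T (u ⊕ v) ≡ T u ⊕ T v) where

  abelianGroup : AbelianGroup 0ℓ 0ℓ
  abelianGroup = record { isAbelianGroup = isAbelianGroup }

  open AbelianGroup abelianGroup using (group; commutativeMonoid; commutativeSemigroup; identityˡ)
  open GroupProperties group using (identityˡ-unique)
  open CommutativeSemigroupProperties commutativeSemigroup using (interchange)
  open Mult commutativeMonoid using (×-distrib-+) renaming (_×_ to _·_) public

  Additive : (V → V) → Set
  Additive F = ∀ u v → F (u ⊕ v) ≡ F u ⊕ F v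

  additive-0 : ∀ {F} → Additive F → F 0v ≡ 0v
  additive-0 {F} F-⊕ = identityˡ-unique (F 0v) (F 0v) (trans (sym (F-⊕ 0v 0v)) (cong F (identityˡ 0v)))

  additive-· : ∀ {F} → Additive F → ∀ c v → F (c · v) ≡ c · F v
  additive-· F-⊕ zero    v = additive-0 F-⊕
  additive-· {F} F-⊕ (suc c) v = trans (F-⊕ v (c · v)) (cong (F v ⊕_) (additive-· F-⊕ c v))

  eval : List ℕ → V → V
  eval []      v = 0v
  eval (c ∷ f) v = (c · v) ⊕ T (eval f v)

  -- Used with F = T, then with F a polynomial in T, which makes all polynomials in T commute, and
  -- finally with F a power map.
  eval-commutes : ∀ {F} → Additive F → (∀ v → F (T v) ≡ T (F v)) → ∀ f v → F (eval f v) ≡ eval f (F v)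
  eval-commutes F-⊕ F-T [] v = additive-0 F-⊕
  eval-commutes F-⊕ F-T (c ∷ f) v = trans (F-⊕ (c · v) (T (eval f v)))
    (cong₂ _⊕_ (additive-· F-⊕ c v) (trans (F-T (eval f v)) (cong T (eval-commutes F-⊕ F-T f v))))

  eval-T : ∀ f v → eval f (T v) ≡ T (eval f v)
  eval-T f v = sym (eval-commutes T-⊕ (λ _ → refl) f v)

  eval-⊕ : ∀ f → Additive (eval f)
  eval-⊕ [] u v = sym (identityˡ 0v)
  eval-⊕ (c ∷ f) u v = trans
    (cong₂ _⊕_ (×-distrib-+ u v c) (trans (cong T (eval-⊕ f u v)) (T-⊕ (eval f u) (eval f v))))
    (interchange _ _ _ _)

  eval-eval : ∀ f g v → eval f (eval g v) ≡ eval g (eval f v)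
  eval-eval f g = eval-commutes (eval-⊕ f) (eval-T f) g

  module CyclicRing (1v : V) (coeffs : V → List ℕ) (eval-coeffs : ∀ v → eval (coeffs v) 1v ≡ v) where

    -- `coeffs` picks a polynomial f with f(T) 1v = u, and the product is f(T) v. No quotient has to
    -- be formed.
    _⊗_ : V → V → V
    u ⊗ v = eval (coeffs u) v

    -- Both products are two commuting polynomials in T applied to the generator.
    ⊗-comm : ∀ u v → u ⊗ v ≡ v ⊗ u
    ⊗-comm u v = begin
      u ⊗ v                        ≡⟨ cong (u ⊗_) (eval-coeffs v) ⟨
      u ⊗ (v ⊗ 1v)                 ≡⟨ eval-eval (coeffs u) (coeffs v) 1v ⟩
      v ⊗ (u ⊗ 1v)                 ≡⟨ cong (v ⊗_) (eval-coeffs u) ⟩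
      v ⊗ u                        ∎
      where open ≡-Reasoning

    ⊗-assoc : ∀ u v w → (u ⊗ v) ⊗ w ≡ u ⊗ (v ⊗ w)
    ⊗-assoc u v w = begin
      (u ⊗ v) ⊗ w   ≡⟨ ⊗-comm (u ⊗ v) w ⟩
      w ⊗ (u ⊗ v)   ≡⟨ eval-eval (coeffs w) (coeffs u) v ⟩
      u ⊗ (w ⊗ v)   ≡⟨ cong (u ⊗_) (⊗-comm w v) ⟩
      u ⊗ (v ⊗ w)   ∎
      where open ≡-Reasoning

    ⊗-distribˡ : ∀ u v w → u ⊗ (v ⊕ w) ≡ (u ⊗ v) ⊕ (u ⊗ w)
    ⊗-distribˡ u = eval-⊕ (coeffs u)

    T1⊗ : ∀ v → T 1v ⊗ v ≡ T v
    T1⊗ v = trans (⊗-comm (T 1v) v) (trans (eval-T (coeffs v) 1v) (cong T (eval-coeffs v)))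

    isCommutativeRing : IsCommutativeRing _≡_ _⊕_ _⊗_ ⊖_ 0v 1v
    isCommutativeRing = record
      { isRing = record
        { +-isAbelianGroup = isAbelianGroup
        ; *-cong = cong₂ _⊗_
        ; *-assoc = ⊗-assoc
        ; *-identity = (λ v → trans (⊗-comm 1v v) (eval-coeffs v)) , eval-coeffs
        ; distrib = ⊗-distribˡ , λ u v w → trans (⊗-comm (v ⊕ w) u) (trans (⊗-distribˡ u v w) (cong₂ _⊕_ (⊗-comm u v) (⊗-comm u w)))
        }
      ; *-comm = ⊗-comm
      }

-- Additivity of the Frobenius map in characteristic p

module Frobenius {c ℓ} (R : CommutativeRing c ℓ) {p : ℕ} (pr : Prime p) where

  open CommutativeRing R using (_≈_; 0#; +-identityˡ; *-identityˡ; *-identityʳ; +-congˡ; +-comm; +-cong; setoid; commutativeSemiring; +-monoid; +-commutativeMonoid)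
    renaming (_+_ to _⊕_; sym to ≈-sym; trans to ≈-trans)
  open Exp commutativeSemiring using (^-assocʳ; ^-congˡ) renaming (_^_ to _↑_)
  open Mult +-commutativeMonoid using (×-congˡ; ×-assocˡ; ×-homo-1) renaming (_×_ to _·_)
  open Binomial commutativeSemiring using (theorem; binomialTerm; binomial)
  open Sum +-monoid using (sum; sum-init-last; sum-cong-≋; sum-replicate-zero)
  open ≈-Reasoning setoid

  module _ (char-p : ∀ x → p · x ≈ 0#) where

    frobenius-+ : ∀ x y → (x ⊕ y) ↑ p ≈ (x ↑ p) ⊕ (y ↑ p)
    frobenius-+ x y = go p refl
      where
      -- With the exponent exposed as a successor, the first and last terms of the binomial sum
      -- split off; p divides all coefficients in between.
      go : ∀ n → n ≡ p → (x ⊕ y) ↑ n ≈ (x ↑ n) ⊕ (y ↑ n)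
      go zero refl with () ← 1<prime pr
      go (suc m) eq = begin
        (x ⊕ y) ↑ suc m                              ≈⟨ theorem (suc m) x y ⟩
        t zero ⊕ sum (t ∘ suc)                       ≈⟨ +-cong first (≈-trans (sum-init-last (t ∘ suc)) (+-cong middle last)) ⟩
        (y ↑ suc m) ⊕ (0# ⊕ (x ↑ suc m))             ≈⟨ +-congˡ (+-identityˡ _) ⟩
        (y ↑ suc m) ⊕ (x ↑ suc m)                    ≈⟨ +-comm _ _ ⟩
        (x ↑ suc m) ⊕ (y ↑ suc m)                    ∎
        where
        t = binomialTerm x y (suc m)
        first : t zero ≈ y ↑ suc m
        first = ≈-trans (×-homo-1 _) (*-identityˡ _)
        last : t (suc (fromℕ m)) ≈ x ↑ suc m
        last rewrite toℕ-fromℕ m | nCn≡1 (suc m) | ℕ.n∸n≡0 m = ≈-trans (×-homo-1 _) (*-identityʳ _)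
        p∣ : ∀ (i : Fin m) → p ∣ suc m C suc (toℕ (inject₁ i))
        p∣ i = prime∣[pʳt]Ck pr 1 1 (prime∤1 pr) (trans eq (sym (trans (ℕ.*-identityʳ (p ^ 1)) (ℕ.^-identityʳ p)))) (toℕ (inject₁ i))
          (subst (suc (toℕ (inject₁ i)) <_) (trans eq (sym (ℕ.^-identityʳ p))) (s≤s (subst (_< m) (sym (toℕ-inject₁ i)) (toℕ<n i))))
        middle : sum (λ i → t (suc (inject₁ i))) ≈ 0#
        middle = ≈-trans (sum-cong-≋ vanish) (sum-replicate-zero m)
          where
          vanish : ∀ i → t (suc (inject₁ i)) ≈ 0#
          vanish i with divides q C≡ ← p∣ i = begin
            (suc m C suc (toℕ (inject₁ i))) · z ≈⟨ ×-congˡ (trans C≡ (ℕ.*-comm q p)) ⟩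
            (p * q) · z                         ≈⟨ ×-assocˡ z p q ⟨
            p · (q · z)                         ≈⟨ char-p (q · z) ⟩
            0#                                  ∎
            where z = binomial x y (suc m) (suc (inject₁ i))

    frobeniusᵃ-+ : ∀ a x y → (x ⊕ y) ↑ (p ^ a) ≈ (x ↑ (p ^ a)) ⊕ (y ↑ (p ^ a))
    frobeniusᵃ-+ zero x y = ≈-trans (*-identityʳ _) (≈-sym (+-cong (*-identityʳ x) (*-identityʳ y)))
    frobeniusᵃ-+ (suc a) x y = begin
      (x ⊕ y) ↑ (p * p ^ a)                          ≈⟨ ^-assocʳ _ p (p ^ a) ⟨
      ((x ⊕ y) ↑ p) ↑ (p ^ a)                        ≈⟨ ^-congˡ (p ^ a) (frobenius-+ x y) ⟩
      ((x ↑ p) ⊕ (y ↑ p)) ↑ (p ^ a)                  ≈⟨ frobeniusᵃ-+ a (x ↑ p) (y ↑ p) ⟩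
      ((x ↑ p) ↑ (p ^ a)) ⊕ ((y ↑ p) ↑ (p ^ a))      ≈⟨ +-cong (^-assocʳ x p (p ^ a)) (^-assocʳ y p (p ^ a)) ⟩
      (x ↑ (p * p ^ a)) ⊕ (y ↑ (p * p ^ a))          ∎

-- slope-injective says that the lines y + slope i x = 0 of Carrier × Carrier meet only in the origin.
record SlopeFamily (n m : ℕ) : Set₁ where
  field
    Carrier         : Set
    _⊕_             : Carrier → Carrier → Carrier
    0#              : Carrier
    ⊖_              : Carrier → Carrier
    isAbelianGroup  : IsAbelianGroup _≡_ _⊕_ 0# ⊖_
    enum            : Carrier ↔ Fin n
    slope           : Fin m → Carrier → Carrier
    slope-⊕         : ∀ i x y → slope i (x ⊕ y) ≡ slope i x ⊕ slope i y
    slope-injective : ∀ {i j} → i ≢ j → ∀ {x} → slope i x ≡ slope j x → x ≡ 0#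

-- A finite commutative ring with rᴺ⁺¹ = r for all r is a product of fields, cut out by its primitive idempotents.

module FiniteRing {R : Set} {_⊕_ _⊗_ : R → R → R} {⊖_ : R → R} {0r 1r : R}
    (isCommutativeRing : IsCommutativeRing _≡_ _⊕_ _⊗_ ⊖_ 0r 1r)
    (_≟_ : DecidableEquality R) (all : List R) (all! : Unique all) (∈-all : ∀ r → r ∈ all) where

  commutativeRing : CommutativeRing 0ℓ 0ℓ
  commutativeRing = record { isCommutativeRing = isCommutativeRing }

  open CommutativeRing commutativeRing using (ring; +-group; commutativeSemiring; +-assoc; +-comm; +-identityˡ; +-identityʳ; -‿inverseˡ; -‿inverseʳ; zeroʳ; *-identityˡ; *-identityʳ; *-assoc; *-comm; distribˡ)
  open RingProperties ring using (-‿distribʳ-*; x[y-z]≈xy-xz; [y-z]x≈yx-zx)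
  open GroupProperties +-group using (∙-cancelʳ; x∙y⁻¹≈ε⇒x≈y; //-rightDividesˡ)
  open Exp commutativeSemiring public using () renaming (_^_ to _↑_)
  open RingSolver (fromCommutativeRing commutativeRing (λ _ → nothing)) using (solve; _⊜_) renaming (_⊕_ to _:+_; _⊗_ to _:*_)
  open ≡-Reasoning

  ⊗-leftComm : ∀ x y z → x ⊗ (y ⊗ z) ≡ y ⊗ (x ⊗ z)
  ⊗-leftComm = solve 3 (λ x y z → (x :* (y :* z)) ⊜ (y :* (x :* z))) refl

  -- For an idempotent e this is the ideal eR, a ring with identity e.
  fixedBy : R → List R
  fixedBy e = filter (λ r → (e ⊗ r) ≟ r) all

  ∈-fixedBy⁺ : ∀ {e r} → e ⊗ r ≡ r → r ∈ fixedBy e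
  ∈-fixedBy⁺ {e} {r} = ∈-filter⁺ (λ r → (e ⊗ r) ≟ r) (∈-all r)

  ∈-fixedBy⁻ : ∀ {e r} → r ∈ fixedBy e → e ⊗ r ≡ r
  ∈-fixedBy⁻ {e} r∈ = proj₂ (∈-filter⁻ (λ r → (e ⊗ r) ≟ r) {xs = all} r∈)

  fixedBy! : ∀ e → Unique (fixedBy e)
  fixedBy! e = Unique.filter⁺ (λ r → (e ⊗ r) ≟ r) all!

  -- The fibres of r ↦ e r are the translates of its kernel.
  length-fixedBy-∣ : ∀ {e} → e ⊗ e ≡ e → length (fixedBy e) ∣ length all
  length-fixedBy-∣ {e} e²≡e = divides c (trans
    (length-if-fibres _≟_ (e ⊗_) c (fixedBy e) (fixedBy! e) all
      (λ {r} _ → ∈-fixedBy⁺ (trans (sym (*-assoc e e r)) (cong (_⊗ r) e²≡e))) fibre)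
    (ℕ.*-comm (length (fixedBy e)) c))
    where
    c = length (filter (λ r → (e ⊗ r) ≟ 0r) all)
    fibre : ∀ {y} → y ∈ fixedBy e → length (filter (λ r → (e ⊗ r) ≟ y) all) ≡ c
    fibre {y} y∈ = ℕ.≤-antisym
      (length-mono-injective {f = _⊕ (⊖ y)} (∙-cancelʳ (⊖ y) _ _) (Unique.filter⁺ (λ r → (e ⊗ r) ≟ y) all!) λ {r} r∈ →
        ∈-filter⁺ (λ r → (e ⊗ r) ≟ 0r) (∈-all _) (begin
          e ⊗ (r ⊕ (⊖ y))          ≡⟨ distribˡ e r (⊖ y) ⟩
          (e ⊗ r) ⊕ (e ⊗ (⊖ y))    ≡⟨ cong₂ _⊕_ (proj₂ (∈-filter⁻ (λ r → (e ⊗ r) ≟ y) {xs = all} r∈))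
                                       (trans (sym (-‿distribʳ-* e y)) (cong ⊖_ (∈-fixedBy⁻ y∈))) ⟩
          y ⊕ (⊖ y)                ≡⟨ -‿inverseʳ y ⟩
          0r                       ∎))
      (length-mono-injective {f = _⊕ y} (∙-cancelʳ y _ _) (Unique.filter⁺ (λ r → (e ⊗ r) ≟ 0r) all!) λ {r} r∈ →
        ∈-filter⁺ (λ r → (e ⊗ r) ≟ y) (∈-all _) (begin
          e ⊗ (r ⊕ y)              ≡⟨ distribˡ e r y ⟩
          (e ⊗ r) ⊕ (e ⊗ y)        ≡⟨ cong₂ _⊕_ (proj₂ (∈-filter⁻ (λ r → (e ⊗ r) ≟ 0r) {xs = all} r∈)) (∈-fixedBy⁻ y∈) ⟩
          0r ⊕ y                   ≡⟨ +-identityˡ y ⟩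
          y                        ∎))

  -- A polynomial is kept as its function together with a Horner form whose innermost value is the
  -- leading coefficient 1; this suffices for counting roots.
  data Monic : ℕ → (R → R) → Set where
    one   : Monic 0 (λ _ → 1r)
    horner : ∀ {d F} → Monic d F → ∀ c → Monic (suc d) (λ x → (x ⊗ F x) ⊕ c)

  -- Synthetic division: the partial Horner value `G r` becomes the constant term of the quotient.
  monic-divide : ∀ {d F} → Monic (suc d) F → ∀ r →
    ∃[ Q ] (Monic d Q × ∀ x → F x ≡ ((x ⊕ (⊖ r)) ⊗ Q x) ⊕ F r)
  monic-divide (horner one c) r = _ , one , λ x → begin
      (x ⊗ 1r) ⊕ c                                          ≡⟨ cong (λ z → (z ⊗ 1r) ⊕ c) (//-rightDividesˡ r x) ⟨
      (((x ⊕ (⊖ r)) ⊕ r) ⊗ 1r) ⊕ c                          ≡⟨ solve 4 (λ d r c o →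
        (((d :+ r) :* o) :+ c) ⊜ ((d :* o) :+ ((r :* o) :+ c))) refl (x ⊕ (⊖ r)) r c 1r ⟩
      ((x ⊕ (⊖ r)) ⊗ 1r) ⊕ ((r ⊗ 1r) ⊕ c)                   ∎
  monic-divide (horner {F = G} m@(horner _ _) c) r with H , monicH , G≡ ← monic-divide m r =
    _ , horner monicH (G r) , λ x → let d = x ⊕ (⊖ r) in begin
      (x ⊗ G x) ⊕ c                                ≡⟨ cong (λ u → (x ⊗ u) ⊕ c) (G≡ x) ⟩
      (x ⊗ ((d ⊗ H x) ⊕ G r)) ⊕ c                  ≡⟨ solve 5 (λ x d h g c →
        ((x :* ((d :* h) :+ g)) :+ c) ⊜ ((d :* (x :* h)) :+ ((x :* g) :+ c))) refl x d (H x) (G r) c ⟩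
      (d ⊗ (x ⊗ H x)) ⊕ ((x ⊗ G r) ⊕ c)            ≡⟨ cong (λ z → (d ⊗ (x ⊗ H x)) ⊕ ((z ⊗ G r) ⊕ c)) (//-rightDividesˡ r x) ⟨
      (d ⊗ (x ⊗ H x)) ⊕ (((d ⊕ r) ⊗ G r) ⊕ c)      ≡⟨ solve 5 (λ d k r g c →
        ((d :* k) :+ (((d :+ r) :* g) :+ c)) ⊜ ((d :* (k :+ g)) :+ ((r :* g) :+ c))) refl d (x ⊗ H x) r (G r) c ⟩
      (d ⊗ ((x ⊗ H x) ⊕ G r)) ⊕ ((r ⊗ G r) ⊕ c)    ∎

  module Regular (N′ : ℕ) (fix : ∀ r → r ↑ suc (suc N′) ≡ r) where

    private N = suc N′

    -- The square is r^(N-1) r^(N+1) = r^(N-1) r. The power r^N is the idempotent generating the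
    -- same ideal as r.
    ↑N-idempotent : ∀ r → (r ↑ N) ⊗ (r ↑ N) ≡ r ↑ N
    ↑N-idempotent r = begin
      (r ⊗ (r ↑ N′)) ⊗ (r ↑ N)   ≡⟨ cong (_⊗ (r ↑ N)) (*-comm r (r ↑ N′)) ⟩
      ((r ↑ N′) ⊗ r) ⊗ (r ↑ N)   ≡⟨ *-assoc (r ↑ N′) r (r ↑ N) ⟩
      (r ↑ N′) ⊗ (r ↑ suc N)     ≡⟨ cong ((r ↑ N′) ⊗_) (fix r) ⟩
      (r ↑ N′) ⊗ r               ≡⟨ *-comm (r ↑ N′) r ⟩
      r ↑ N                      ∎

    ↑N≢0 : ∀ {r} → r ≢ 0r → r ↑ N ≢ 0r
    ↑N≢0 {r} r≢0 eq = r≢0 (trans (sym (fix r)) (trans (cong (r ⊗_) eq) (zeroʳ r)))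

    -- `minimal` says that the idempotent attached to any nonzero r of eR is e itself, so r is
    -- invertible in eR and eR is a field.
    record Primitive (e : R) : Set where
      field
        nonzero    : e ≢ 0r
        idempotent : e ⊗ e ≡ e
        minimal    : ∀ {r} → e ⊗ r ≡ r → r ≢ 0r → r ↑ N ≡ e

    -- If `minimal` fails at r, then r^N is a nonzero idempotent whose ideal lies in eR and misses
    -- e; descend on the size of the ideal. `f ⊗ e ≡ f` records that f stays below e.
    ∃-primitive : ∀ e → e ≢ 0r → e ⊗ e ≡ e → ∃[ f ] (Primitive f × f ⊗ e ≡ f)
    ∃-primitive e = go e (<-wellFounded (length (fixedBy e)))
      where
      go : ∀ e → Acc _<_ (length (fixedBy e)) → e ≢ 0r → e ⊗ e ≡ e → ∃[ f ] (Primitive f × f ⊗ e ≡ f)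
      go e (acc rec) e≢0 e²≡e with any? (λ r → ((e ⊗ r) ≟ r) ×-dec ¬? (r ≟ 0r) ×-dec ¬? ((r ↑ N) ≟ e)) all
      ... | no none = e , record { nonzero = e≢0 ; idempotent = e²≡e ; minimal = λ {r} er≡r r≢0 →
              case (r ↑ N) ≟ e of λ { (yes eq) → eq ; (no neq) → contradiction (lose (∈-all r) (er≡r , r≢0 , neq)) none } } , e²≡e
      ... | yes some with r , _ , er≡r , r≢0 , rᴺ≢e ← find some =
          let f , prim , fe′≡f = go e′ (rec smaller) (↑N≢0 r≢0) (↑N-idempotent r) in
          f , prim , (begin
            f ⊗ e          ≡⟨ cong (_⊗ e) fe′≡f ⟨
            (f ⊗ e′) ⊗ e   ≡⟨ *-assoc f e′ e ⟩
            f ⊗ (e′ ⊗ e)   ≡⟨ cong (f ⊗_) (trans (*-comm e′ e) ee′≡e′) ⟩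
            f ⊗ e′         ≡⟨ fe′≡f ⟩
            f              ∎)
        where
        e′ = r ↑ N
        ee′≡e′ : e ⊗ e′ ≡ e′
        ee′≡e′ = trans (sym (*-assoc e r (r ↑ N′))) (cong (_⊗ (r ↑ N′)) er≡r)
        smaller : length (fixedBy e′) < length (fixedBy e)
        smaller = length-mono-⊆ {xs = e ∷ fixedBy e′}
          (All.tabulate (λ { x∈ refl → rᴺ≢e (trans (sym ee′≡e′) (trans (*-comm e e′) (∈-fixedBy⁻ x∈))) }) ∷ fixedBy! e′)
          λ { (here refl) → ∈-fixedBy⁺ e²≡e
            ; {x} (there x∈) → ∈-fixedBy⁺ (begin
                e ⊗ x          ≡⟨ cong (e ⊗_) (∈-fixedBy⁻ x∈) ⟨
                e ⊗ (e′ ⊗ x)   ≡⟨ *-assoc e e′ x ⟨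
                (e ⊗ e′) ⊗ x   ≡⟨ cong (_⊗ x) ee′≡e′ ⟩
                e′ ⊗ x         ≡⟨ ∈-fixedBy⁻ x∈ ⟩
                x              ∎) }

    module PrimitiveIdempotent {e : R} (e-primitive : Primitive e) where

      open Primitive e-primitive

      -- Multiplying x y = 0 by x^(N-1) turns x into e.
      domain : ∀ {x y} → e ⊗ x ≡ x → x ≢ 0r → x ⊗ y ≡ 0r → e ⊗ y ≡ 0r
      domain {x} {y} ex≡x x≢0 xy≡0 = begin
        e ⊗ y                  ≡⟨ cong (_⊗ y) (minimal ex≡x x≢0) ⟨
        (x ⊗ (x ↑ N′)) ⊗ y     ≡⟨ cong (_⊗ y) (*-comm x (x ↑ N′)) ⟩
        ((x ↑ N′) ⊗ x) ⊗ y     ≡⟨ *-assoc (x ↑ N′) x y ⟩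
        (x ↑ N′) ⊗ (x ⊗ y)     ≡⟨ cong ((x ↑ N′) ⊗_) xy≡0 ⟩
        (x ↑ N′) ⊗ 0r          ≡⟨ zeroʳ (x ↑ N′) ⟩
        0r                     ∎

      e⊗[x-y] : ∀ {x y} → e ⊗ x ≡ x → e ⊗ y ≡ y → e ⊗ (x ⊕ (⊖ y)) ≡ x ⊕ (⊖ y)
      e⊗[x-y] {x} {y} ex≡x ey≡y = trans (distribˡ e x (⊖ y)) (cong₂ _⊕_ ex≡x (trans (sym (-‿distribʳ-* e y)) (cong ⊖_ ey≡y)))

      -- The usual induction, dividing by x - r. Coefficients lie in R, which has zero divisors, so
      -- values are compared only after multiplication by e, where `domain` cancels x - r.
      roots-bound : ∀ {d F} → Monic d F → ∀ {xs} → Unique xs → (∀ {x} → x ∈ xs → e ⊗ x ≡ x × e ⊗ F x ≡ 0r) → length xs ≤ d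
      roots-bound _ {[]} _ _ = z≤n
      roots-bound one {r ∷ xs} _ roots = contradiction (trans (sym (*-identityʳ e)) (proj₂ (roots (here refl)))) nonzero
      roots-bound {F = F} m@(horner _ _) {r ∷ xs} (r∉xs ∷ xs!) roots with Q , monicQ , F≡ ← monic-divide m r =
        s≤s (roots-bound monicQ xs! λ {x} x∈ → proj₁ (roots (there x∈)) , (begin
          e ⊗ Q x            ≡⟨ cong (_⊗ Q x) idempotent ⟨
          (e ⊗ e) ⊗ Q x      ≡⟨ *-assoc e e (Q x) ⟩
          e ⊗ (e ⊗ Q x)      ≡⟨ domain (e⊗[x-y] (proj₁ (roots (there x∈))) (proj₁ (roots (here refl))))
                                 (λ x-r≡0 → All.lookup r∉xs x∈ (sym (x∙y⁻¹≈ε⇒x≈y x r x-r≡0))) (begin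
            (x ⊕ (⊖ r)) ⊗ (e ⊗ Q x)              ≡⟨ ⊗-leftComm (x ⊕ (⊖ r)) e (Q x) ⟩
            e ⊗ ((x ⊕ (⊖ r)) ⊗ Q x)              ≡⟨ +-identityʳ _ ⟨
            (e ⊗ ((x ⊕ (⊖ r)) ⊗ Q x)) ⊕ 0r       ≡⟨ cong ((e ⊗ ((x ⊕ (⊖ r)) ⊗ Q x)) ⊕_) (proj₂ (roots (here refl))) ⟨
            (e ⊗ ((x ⊕ (⊖ r)) ⊗ Q x)) ⊕ (e ⊗ F r) ≡⟨ distribˡ e _ _ ⟨
            e ⊗ (((x ⊕ (⊖ r)) ⊗ Q x) ⊕ F r)      ≡⟨ cong (e ⊗_) (F≡ x) ⟨
            e ⊗ F x                              ≡⟨ proj₂ (roots (there x∈)) ⟩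
            0r                                   ∎) ⟩
          0r                 ∎))

      monic-↑ : ∀ d → ∃[ F ] (Monic d F × ∀ x → F x ≡ x ↑ d)
      monic-↑ zero = _ , one , λ _ → refl
      monic-↑ (suc d) with F , m , F≡ ← monic-↑ d = _ , horner m 0r , λ x → trans (+-identityʳ _) (cong (x ⊗_) (F≡ x))

      length-fixedBy-≤ : length (fixedBy e) ≤ suc N
      -- The polynomial is x^(N+1) - x in Horner form, built on x^(N-1).
      length-fixedBy-≤ with F , m , F≡ ← monic-↑ N′ = roots-bound (horner (horner m (⊖ 1r)) 0r) (fixedBy! e)
        λ {x} x∈ → ∈-fixedBy⁻ x∈ , trans (cong (e ⊗_) (begin
          (x ⊗ ((x ⊗ F x) ⊕ (⊖ 1r))) ⊕ 0r         ≡⟨ +-identityʳ _ ⟩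
          x ⊗ ((x ⊗ F x) ⊕ (⊖ 1r))                ≡⟨ distribˡ x _ _ ⟩
          (x ⊗ (x ⊗ F x)) ⊕ (x ⊗ (⊖ 1r))          ≡⟨ cong₂ _⊕_ (trans (cong (λ u → x ⊗ (x ⊗ u)) (F≡ x)) (fix x))
                                                     (trans (sym (-‿distribʳ-* x 1r)) (cong ⊖_ (*-identityʳ x))) ⟩
          x ⊕ (⊖ x)                               ≡⟨ -‿inverseʳ x ⟩
          0r                                      ∎)) (zeroʳ e)

      units : List R
      units = filter (λ r → ¬? (r ≟ 0r)) (fixedBy e)

      units! : Unique units
      units! = Unique.filter⁺ (λ r → ¬? (r ≟ 0r)) (fixedBy! e)

      ∈-units⁺ : ∀ {r} → e ⊗ r ≡ r → r ≢ 0r → r ∈ units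
      ∈-units⁺ er≡r = ∈-filter⁺ (λ r → ¬? (r ≟ 0r)) (∈-fixedBy⁺ er≡r)

      ∈-units⁻ : ∀ {r} → r ∈ units → e ⊗ r ≡ r × r ≢ 0r
      ∈-units⁻ r∈ with r∈e , r≢0 ← ∈-filter⁻ (λ r → ¬? (r ≟ 0r)) {xs = fixedBy e} r∈ = ∈-fixedBy⁻ r∈e , r≢0

      length-fixedBy : length (fixedBy e) ≡ suc (length units)
      length-fixedBy = ℕ.≤-antisym
        (length-mono-⊆ {ys = 0r ∷ units} (fixedBy! e) λ {r} r∈ → case r ≟ 0r of λ
          { (yes r≡0) → here r≡0 ; (no r≢0) → there (∈-units⁺ (∈-fixedBy⁻ r∈) r≢0) })
        (length-mono-⊆ {xs = 0r ∷ units} (All.tabulate (λ { r∈ refl → proj₂ (∈-units⁻ r∈) refl }) ∷ units!)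
          λ { (here refl) → ∈-fixedBy⁺ (zeroʳ e) ; (there r∈) → ∈-fixedBy⁺ (proj₁ (∈-units⁻ r∈)) })

      product : List R → R
      product = foldr _⊗_ 1r

      product-map : ∀ t xs → product (map (t ⊗_) xs) ≡ (t ↑ length xs) ⊗ product xs
      product-map t [] = sym (*-identityʳ 1r)
      product-map t (x ∷ xs) = trans (cong ((t ⊗ x) ⊗_) (product-map t xs))
        (solve 4 (λ t x u v → ((t :* x) :* (u :* v)) ⊜ ((t :* u) :* (x :* v))) refl t x (t ↑ length xs) (product xs))

      product≢0 : ∀ xs → (∀ {x} → x ∈ xs → x ∈ units) → e ⊗ product xs ≢ 0r
      product≢0 [] _ eq = nonzero (trans (sym (*-identityʳ e)) eq)
      product≢0 (x ∷ xs) xs⊆ eq with ex≡x , x≢0 ← ∈-units⁻ (xs⊆ (here refl)) = product≢0 xs (xs⊆ ∘ there)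
        (domain ex≡x x≢0 (trans (cong (_⊗ product xs) (sym ex≡x)) (trans (*-assoc e x (product xs)) eq)))

      -- As in Fermat's little theorem, multiplication by the unit t permutes the nonzero elements of the field.
      unit-↑-units : ∀ {t} → t ↑ N ≡ 1r → e ⊗ (t ↑ length units) ≡ e
      unit-↑-units {t} tᴺ≡1 = x∙y⁻¹≈ε⇒x≈y _ _ (begin
        (e ⊗ u) ⊕ (⊖ e)              ≡⟨ cong (λ z → (e ⊗ u) ⊕ (⊖ z)) (*-identityʳ e) ⟨
        (e ⊗ u) ⊕ (⊖ (e ⊗ 1r))       ≡⟨ cong ((e ⊗ u) ⊕_) (-‿distribʳ-* e 1r) ⟩
        (e ⊗ u) ⊕ (e ⊗ (⊖ 1r))       ≡⟨ distribˡ e u (⊖ 1r) ⟨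
        e ⊗ (u ⊕ (⊖ 1r))             ≡⟨ domain (trans (sym (*-assoc e e P)) (cong (_⊗ P) idempotent)) (product≢0 units id) (begin
          (e ⊗ P) ⊗ (u ⊕ (⊖ 1r))           ≡⟨ *-assoc e P _ ⟩
          e ⊗ (P ⊗ (u ⊕ (⊖ 1r)))           ≡⟨ cong (e ⊗_) (x[y-z]≈xy-xz P u 1r) ⟩
          e ⊗ ((P ⊗ u) ⊕ (⊖ (P ⊗ 1r)))     ≡⟨ cong (e ⊗_) (cong₂ (λ x y → x ⊕ (⊖ y)) (trans (*-comm P u) product-fixed) (*-identityʳ P)) ⟩
          e ⊗ (P ⊕ (⊖ P))                  ≡⟨ cong (e ⊗_) (-‿inverseʳ P) ⟩
          e ⊗ 0r                           ≡⟨ zeroʳ e ⟩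
          0r                               ∎) ⟩
        0r                           ∎)
        where
        u = t ↑ length units
        P = product units
        t⁻¹t : ∀ x → (t ↑ N′) ⊗ (t ⊗ x) ≡ x
        t⁻¹t x = trans (sym (*-assoc _ t x)) (trans (cong (_⊗ x) (trans (*-comm _ t) tᴺ≡1)) (*-identityˡ x))
        t-injective : ∀ {x y} → t ⊗ x ≡ t ⊗ y → x ≡ y
        t-injective {x} {y} eq = trans (sym (t⁻¹t x)) (trans (cong ((t ↑ N′) ⊗_) eq) (t⁻¹t y))
        t-units : ∀ {x} → x ∈ units → t ⊗ x ∈ units
        t-units {x} x∈ = ∈-units⁺ (trans (⊗-leftComm e t x) (cong (t ⊗_) (proj₁ (∈-units⁻ x∈))))
          (λ tx≡0 → proj₂ (∈-units⁻ x∈) (t-injective (trans tx≡0 (sym (zeroʳ t)))))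
        t[t⁻¹x] : ∀ x → t ⊗ ((t ↑ N′) ⊗ x) ≡ x
        t[t⁻¹x] x = trans (⊗-leftComm t (t ↑ N′) x) (t⁻¹t x)
        t⁻¹-units : ∀ {x} → x ∈ units → (t ↑ N′) ⊗ x ∈ units
        t⁻¹-units {x} x∈ = ∈-units⁺ (trans (⊗-leftComm e (t ↑ N′) x) (cong ((t ↑ N′) ⊗_) (proj₁ (∈-units⁻ x∈))))
          (λ t⁻¹x≡0 → proj₂ (∈-units⁻ x∈) (trans (sym (t[t⁻¹x] x)) (trans (cong (t ⊗_) t⁻¹x≡0) (zeroʳ t))))
        permuted : map (t ⊗_) units ↭ units
        permuted = ∼bag⇒↭ (unique∧set⇒bag (Unique.map⁺ t-injective units!) units! (λ {x} → mk⇔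
          (λ x∈ → case ∈-map⁻ (t ⊗_) x∈ of λ { (y , y∈ , refl) → t-units y∈ })
          (λ x∈ → subst (_∈ map (t ⊗_) units) (t[t⁻¹x] x) (∈-map⁺ (t ⊗_) (t⁻¹-units x∈)))))
        product-fixed : u ⊗ P ≡ P
        product-fixed = trans (sym (product-map t units)) (↭.foldr-commMonoid (≡.setoid R) (CommutativeRing.*-isCommutativeMonoid commutativeRing) (↭⇒↭ₛ permuted))

      -- The slopes are the multiplications by all elements of the field eR; two distinct ones
      -- differ by multiplication by a nonzero element.
      slopeFamily : SlopeFamily (length (fixedBy e)) (length (fixedBy e))
      slopeFamily = record
        { Carrier = ∃[ r ] e ⊗ r ≡ r
        ; _⊕_ = λ (x , ex) (y , ey) → x ⊕ y , trans (distribˡ e x y) (cong₂ _⊕_ ex ey)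
        ; 0# = 0r , zeroʳ e
        ; ⊖_ = λ (x , ex) → ⊖ x , trans (sym (-‿distribʳ-* e x)) (cong ⊖_ ex)
        ; isAbelianGroup = record
          { isGroup = record
            { isMonoid = record
              { isSemigroup = record
                { isMagma = record { isEquivalence = isEquivalence ; ∙-cong = λ { refl refl → refl } }
                ; assoc = λ x y z → ≡-ext (+-assoc (proj₁ x) (proj₁ y) (proj₁ z)) }
              ; identity = (λ x → ≡-ext (+-identityˡ (proj₁ x))) , (λ x → ≡-ext (+-identityʳ (proj₁ x))) }
            ; inverse = (λ x → ≡-ext (-‿inverseˡ (proj₁ x))) , (λ x → ≡-ext (-‿inverseʳ (proj₁ x)))
            ; ⁻¹-cong = λ { refl → refl } }
          ; comm = λ x y → ≡-ext (+-comm (proj₁ x) (proj₁ y)) }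
        ; enum = mk↔ₛ′ (λ (r , er) → Any.index (∈-fixedBy⁺ er)) element
            (λ i → lookup-injective (fixedBy! e) _ i (sym (lookup-index (∈-fixedBy⁺ (proj₂ (element i))))))
            (λ (r , er) → ≡-ext (sym (lookup-index (∈-fixedBy⁺ er))))
        ; slope = λ i (x , ex) → let k = List.lookup (fixedBy e) i in k ⊗ x , trans (⊗-leftComm e k x) (cong (k ⊗_) ex)
        ; slope-⊕ = λ i x y → ≡-ext (distribˡ (List.lookup (fixedBy e) i) (proj₁ x) (proj₁ y))
        ; slope-injective = λ {i} {j} i≢j {(x , ex)} eq → ≡-ext (trans (sym ex) (domain
            (e⊗[x-y] (proj₂ (element i)) (proj₂ (element j)))
            (i≢j ∘ lookup-injective (fixedBy! e) i j ∘ x∙y⁻¹≈ε⇒x≈y _ _)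
            (trans ([y-z]x≈yx-zx x _ _) (trans (cong (λ z → z ⊕ (⊖ (List.lookup (fixedBy e) j ⊗ x))) (cong proj₁ eq)) (-‿inverseʳ _)))))
        }
        where
        ≡-ext : {x y : ∃[ r ] e ⊗ r ≡ r} → proj₁ x ≡ proj₁ y → x ≡ y
        ≡-ext {x , ex} {.x , ex′} refl = cong (x ,_) (uip ex ex′)
        element : Fin (length (fixedBy e)) → ∃[ r ] e ⊗ r ≡ r
        element i = List.lookup (fixedBy e) i , ∈-fixedBy⁻ (∈-lookup i)

-- Integers modulo p and vectors over them

length-cartesianProductWith : {A B C : Set} (f : A → B → C) (xs : List A) (ys : List B) →
  length (cartesianProductWith f xs ys) ≡ length xs * length ys
length-cartesianProductWith f [] ys = refl
length-cartesianProductWith f (x ∷ xs) ys = trans (length-++ (map (f x) ys))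
  (cong₂ _+_ (length-map (f x) ys) (length-cartesianProductWith f xs ys))

allVec : ∀ m n → List (Vec (Fin m) n)
allVec m zero    = [] ∷ []
allVec m (suc n) = cartesianProductWith _∷_ (allFin m) (allVec m n)

allVec! : ∀ m n → Unique (allVec m n)
allVec! m zero    = [] ∷ []
allVec! m (suc n) = Unique.cartesianProductWith⁺ _∷_ ∷-injective (Unique.allFin⁺ m) (allVec! m n)

∈-allVec : ∀ {m n} (v : Vec (Fin m) n) → v ∈ allVec m n
∈-allVec []      = here refl
∈-allVec (x ∷ v) = ∈-cartesianProductWith⁺ _∷_ (∈-allFin x) (∈-allVec v)

length-allVec : ∀ m n → length (allVec m n) ≡ m ^ n
length-allVec m zero    = refl
length-allVec m (suc n) = trans (length-cartesianProductWith _∷_ (allFin m) (allVec m n))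
  (cong₂ _*_ (length-tabulate {n = m} id) (length-allVec m n))

module Modular (p : ℕ) .⦃ _ : NonZero p ⦄ where

  [_] : ℕ → Fin p
  [ m ] = m mod p

  toℕ-[] : ∀ m → toℕ [ m ] ≡ m % p
  toℕ-[] m = toℕ-fromℕ< (m%n<n m p)

  [toℕ] : ∀ i → [ toℕ i ] ≡ i
  [toℕ] i = toℕ-injective (trans (toℕ-[] (toℕ i)) (m<n⇒m%n≡m (toℕ<n i)))

  _+ₚ_ : Fin p → Fin p → Fin p
  i +ₚ j = [ toℕ i + toℕ j ]

  -ₚ_ : Fin p → Fin p
  -ₚ i = [ p ∸ toℕ i ]

  []-+ : ∀ m n → [ m ] +ₚ [ n ] ≡ [ m + n ]
  []-+ m n = toℕ-injective (begin
    toℕ [ toℕ [ m ] + toℕ [ n ] ]    ≡⟨ toℕ-[] _ ⟩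
    (toℕ [ m ] + toℕ [ n ]) % p      ≡⟨ cong₂ (λ a b → (a + b) % p) (toℕ-[] m) (toℕ-[] n) ⟩
    (m % p + n % p) % p              ≡⟨ %-distribˡ-+ m n p ⟨
    (m + n) % p                      ≡⟨ toℕ-[] (m + n) ⟨
    toℕ [ m + n ]                    ∎)
    where open ≡-Reasoning

  [p]≡[0] : [ p ] ≡ [ 0 ]
  [p]≡[0] = toℕ-injective (trans (toℕ-[] p) (trans (n%n≡0 p) (sym (trans (toℕ-[] 0) (m*n%n≡0 0 p)))))

  +ₚ-comm : ∀ i j → i +ₚ j ≡ j +ₚ i
  +ₚ-comm i j = cong [_] (ℕ.+-comm (toℕ i) (toℕ j))

  +ₚ-assoc : ∀ i j k → (i +ₚ j) +ₚ k ≡ i +ₚ (j +ₚ k)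
  +ₚ-assoc i j k = begin
    [ toℕ i + toℕ j ] +ₚ k                     ≡⟨ cong ([ toℕ i + toℕ j ] +ₚ_) ([toℕ] k) ⟨
    [ toℕ i + toℕ j ] +ₚ [ toℕ k ]             ≡⟨ []-+ _ _ ⟩
    [ toℕ i + toℕ j + toℕ k ]                  ≡⟨ cong [_] (ℕ.+-assoc (toℕ i) (toℕ j) (toℕ k)) ⟩
    [ toℕ i + (toℕ j + toℕ k) ]                ≡⟨ []-+ _ _ ⟨
    [ toℕ i ] +ₚ [ toℕ j + toℕ k ]             ≡⟨ cong (_+ₚ [ toℕ j + toℕ k ]) ([toℕ] i) ⟩
    i +ₚ (j +ₚ k)                              ∎
    where open ≡-Reasoning

  +ₚ-identityʳ : ∀ i → i +ₚ [ 0 ] ≡ i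
  +ₚ-identityʳ i = trans (cong (_+ₚ [ 0 ]) (sym ([toℕ] i))) (trans ([]-+ (toℕ i) 0) (trans (cong [_] (ℕ.+-identityʳ (toℕ i))) ([toℕ] i)))

  +ₚ-inverseʳ : ∀ i → i +ₚ (-ₚ i) ≡ [ 0 ]
  +ₚ-inverseʳ i = trans (cong (_+ₚ (-ₚ i)) (sym ([toℕ] i))) (trans ([]-+ (toℕ i) (p ∸ toℕ i))
    (trans (cong [_] (ℕ.m+[n∸m]≡n (ℕ.<⇒≤ (toℕ<n i)))) [p]≡[0]))

  +ₚ-isAbelianGroup : IsAbelianGroup _≡_ _+ₚ_ [ 0 ] -ₚ_
  +ₚ-isAbelianGroup = record
    { isGroup = record
      { isMonoid = record
        { isSemigroup = record
          { isMagma = record { isEquivalence = isEquivalence ; ∙-cong = cong₂ _+ₚ_ }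
          ; assoc = +ₚ-assoc }
        ; identity = (λ i → trans (+ₚ-comm [ 0 ] i) (+ₚ-identityʳ i)) , +ₚ-identityʳ }
      ; inverse = (λ i → trans (+ₚ-comm (-ₚ i) i) (+ₚ-inverseʳ i)) , +ₚ-inverseʳ
      ; ⁻¹-cong = cong -ₚ_ }
    ; comm = +ₚ-comm }

  private
    +ₚ-abelianGroup : AbelianGroup 0ℓ 0ℓ
    +ₚ-abelianGroup = record { isAbelianGroup = +ₚ-isAbelianGroup }

  open Mult (AbelianGroup.commutativeMonoid +ₚ-abelianGroup) using () renaming (_×_ to _·ₚ_) public

  ·ₚ≡[*] : ∀ m i → m ·ₚ i ≡ [ m * toℕ i ]
  ·ₚ≡[*] zero    i = refl
  ·ₚ≡[*] (suc m) i = trans (cong₂ _+ₚ_ (sym ([toℕ] i)) (·ₚ≡[*] m i)) ([]-+ (toℕ i) (m * toℕ i))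

  -ₚ0≡0 : -ₚ [ 0 ] ≡ [ 0 ]
  -ₚ0≡0 = GroupProperties.ε⁻¹≈ε (AbelianGroup.group +ₚ-abelianGroup)

  p·ₚ : ∀ i → p ·ₚ i ≡ [ 0 ]
  p·ₚ i = trans (·ₚ≡[*] p i) (toℕ-injective (trans (toℕ-[] _)
    (trans (cong (_% p) (ℕ.*-comm p (toℕ i))) (trans (m*n%n≡0 (toℕ i) p) (sym (trans (toℕ-[] 0) (m*n%n≡0 0 p)))))))

  module _ {n : ℕ} where
    zipWith-+ₚ-isAbelianGroup : IsAbelianGroup _≡_ (zipWith {n = n} _+ₚ_) (replicate n [ 0 ]) (Vec.map -ₚ_)
    zipWith-+ₚ-isAbelianGroup = record
      { isGroup = record
        { isMonoid = record
          { isSemigroup = record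
            { isMagma = record { isEquivalence = isEquivalence ; ∙-cong = cong₂ (zipWith _+ₚ_) }
            ; assoc = zipWith-assoc +ₚ-assoc }
          ; identity = zipWith-identityˡ (proj₁ identity) , zipWith-identityʳ +ₚ-identityʳ }
        ; inverse = zipWith-inverseˡ (proj₁ inverse) , zipWith-inverseʳ +ₚ-inverseʳ
        ; ⁻¹-cong = cong (Vec.map -ₚ_) }
      ; comm = zipWith-comm +ₚ-comm }
      where open IsAbelianGroup +ₚ-isAbelianGroup using (identity; inverse)

  _·ᵥ_ : ∀ {n} → ℕ → Vec (Fin p) n → Vec (Fin p) n
  _·ᵥ_ {n} = Mult._×_ (AbelianGroup.commutativeMonoid (record { isAbelianGroup = zipWith-+ₚ-isAbelianGroup {n} }))

  ·ᵥ-∷ : ∀ {n} c x (v : Vec (Fin p) n) → c ·ᵥ (x ∷ v) ≡ (c ·ₚ x) ∷ (c ·ᵥ v)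
  ·ᵥ-∷ zero    x v = refl
  ·ᵥ-∷ (suc c) x v = cong (zipWith _+ₚ_ (x ∷ v)) (·ᵥ-∷ c x v)

  p·ᵥ : ∀ {n} (v : Vec (Fin p) n) → p ·ᵥ v ≡ replicate n [ 0 ]
  p·ᵥ []      with [] ← p ·ᵥ [] = refl
  p·ᵥ (x ∷ v) = trans (·ᵥ-∷ p x v) (cong₂ _∷_ (p·ₚ x) (p·ᵥ v))

-- The group algebra of the cyclic group of order suc n over the integers mod p. Coordinates are listed from the
-- coefficient of tⁿ down to that of 1, so that the generator t acts by rotation to the left.

rotate : {A : Set} {n : ℕ} → Vec A (suc n) → Vec A (suc n)
rotate (x ∷ xs) = xs ∷ʳ x

zipWith-∷ʳ : {A : Set} (f : A → A → A) {n : ℕ} (xs ys : Vec A n) (x y : A) →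
  zipWith f (xs ∷ʳ x) (ys ∷ʳ y) ≡ zipWith f xs ys ∷ʳ f x y
zipWith-∷ʳ f []       []       x y = refl
zipWith-∷ʳ f (_ ∷ xs) (_ ∷ ys) x y = cong (_ ∷_) (zipWith-∷ʳ f xs ys x y)

iter : {A : Set} → (A → A) → ℕ → A → A
iter f zero    x = x
iter f (suc k) x = iter f k (f x)

module GroupAlgebra (p : ℕ) .⦃ _ : NonZero p ⦄ (n : ℕ) where

  open Modular p

  V : ℕ → Set
  V = Vec (Fin p)

  T : V (suc n) → V (suc n)
  T = rotate

  T-⊕ : ∀ u v → T (zipWith _+ₚ_ u v) ≡ zipWith _+ₚ_ (T u) (T v)
  T-⊕ (x ∷ xs) (y ∷ ys) = sym (zipWith-∷ʳ _+ₚ_ xs ys x y)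

  module C = CyclicModule {V (suc n)} zipWith-+ₚ-isAbelianGroup T-⊕
  open C using (_·_; eval)

  δ : V (suc n)
  δ = replicate n [ 0 ] ∷ʳ [ 1 ]

  replicate-∷ʳ : ∀ {A : Set} n (x : A) → replicate n x ∷ʳ x ≡ replicate (suc n) x
  replicate-∷ʳ zero    x = refl
  replicate-∷ʳ (suc n) x = cong (x ∷_) (replicate-∷ʳ n x)

  ·δ : ∀ c → c · δ ≡ replicate n [ 0 ] ∷ʳ [ c ]
  ·δ zero    = sym (replicate-∷ʳ n [ 0 ])
  ·δ (suc c) = trans (cong (zipWith _+ₚ_ δ) (·δ c)) (trans (zipWith-∷ʳ _+ₚ_ (replicate n [ 0 ]) (replicate n [ 0 ]) [ 1 ] [ c ])
    (cong₂ _∷ʳ_ (zipWith-identityˡ (λ i → trans (+ₚ-comm [ 0 ] i) (+ₚ-identityʳ i)) (replicate n [ 0 ])) ([]-+ 1 c)))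

  data Zeros : ∀ {m} → ℕ → V m → Set where
    none : ∀ {m} {v : V m} → Zeros 0 v
    more : ∀ {m k} {v : V m} → Zeros k v → Zeros (suc k) ([ 0 ] ∷ v)

  zeros-init : ∀ {m k} (v : V m) {x} → k ≤ m → Zeros k (v ∷ʳ x) → Zeros k v
  zeros-init {k = zero}  v       _         _        = none
  zeros-init {k = suc k} (_ ∷ v) (s≤s k≤m) (more z) = more (zeros-init v k≤m z)

  zeros-all : ∀ {m} {v : V m} → Zeros m v → v ≡ replicate m [ 0 ]
  zeros-all {v = []} none  = refl
  zeros-all (more z) = cong ([ 0 ] ∷_) (zeros-all z)

  -- The last coordinate is the constant term; shifting a 0 in from the left divides the remainder
  -- by t.
  coeffs : ℕ → V (suc n) → List ℕ
  coeffs zero    v = []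
  coeffs (suc k) v = let ys , y , _ = initLast v in toℕ y ∷ coeffs k ([ 0 ] ∷ ys)

  -- j counts the divisions by t already made, each leaving one more zero in front. When k runs out,
  -- all coordinates are zero.
  eval-coeffs : ∀ k j v → k + j ≡ suc n → Zeros j v → eval (coeffs k v) δ ≡ v
  eval-coeffs zero    j v refl z = sym (zeros-all z)
  eval-coeffs (suc k) j v k+j≡n z with ys , y , refl ← initLast v = begin
    zipWith _+ₚ_ (toℕ y · δ) (T (eval (coeffs k ([ 0 ] ∷ ys)) δ))
      ≡⟨ cong₂ (zipWith _+ₚ_) (trans (·δ (toℕ y)) (cong (replicate n [ 0 ] ∷ʳ_) ([toℕ] y)))
           (cong T (eval-coeffs k (suc j) ([ 0 ] ∷ ys) (trans (ℕ.+-suc k j) k+j≡n)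
             (more (zeros-init ys (ℕ.≤-trans (ℕ.m≤n+m j k) (ℕ.≤-reflexive (ℕ.suc-injective k+j≡n))) z)))) ⟩
    zipWith _+ₚ_ (replicate n [ 0 ] ∷ʳ y) (ys ∷ʳ [ 0 ])
      ≡⟨ zipWith-∷ʳ _+ₚ_ (replicate n [ 0 ]) ys y [ 0 ] ⟩
    zipWith _+ₚ_ (replicate n [ 0 ]) ys ∷ʳ (y +ₚ [ 0 ])
      ≡⟨ cong₂ _∷ʳ_ (zipWith-identityˡ (λ i → trans (+ₚ-comm [ 0 ] i) (+ₚ-identityʳ i)) ys) (+ₚ-identityʳ y) ⟩
    ys ∷ʳ y ∎
    where open ≡-Reasoning

  open C.CyclicRing δ (coeffs (suc n)) (λ v → eval-coeffs (suc n) 0 v (ℕ.+-identityʳ (suc n)) none) public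
    using (_⊗_; isCommutativeRing; T1⊗)

  ring : CommutativeRing 0ℓ 0ℓ
  ring = record { isCommutativeRing = isCommutativeRing }

  open CommutativeRing ring using (*-assoc; *-comm; *-identityˡ; *-identityʳ; commutativeSemiring; -‿inverseʳ; zeroˡ; zeroʳ)
  open RingProperties (CommutativeRing.ring ring) using (x[y-z]≈xy-xz; [y-z]x≈yx-zx)
  open Exp commutativeSemiring using (^-distrib-*) renaming (_^_ to _↑_)

  t : V (suc n)
  t = T δ

  t↑⊗ : ∀ k v → (t ↑ k) ⊗ v ≡ iter T k v
  t↑⊗ zero    v = *-identityˡ v
  t↑⊗ (suc k) v = begin
    (t ⊗ (t ↑ k)) ⊗ v   ≡⟨ cong (_⊗ v) (*-comm t (t ↑ k)) ⟩
    ((t ↑ k) ⊗ t) ⊗ v   ≡⟨ *-assoc (t ↑ k) t v ⟩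
    (t ↑ k) ⊗ (t ⊗ v)   ≡⟨ cong ((t ↑ k) ⊗_) (T1⊗ v) ⟩
    (t ↑ k) ⊗ T v       ≡⟨ t↑⊗ k (T v) ⟩
    iter T (suc k) v    ∎
    where open ≡-Reasoning

  -- In length n + 1, `UnitVector j v` says that v is the power t^(n - j).
  data UnitVector : ∀ {m} → ℕ → V m → Set where
    unit : ∀ {m} → UnitVector 0 ([ 1 ] ∷ replicate m [ 0 ])
    zero∷ : ∀ {m j} {v : V m} → UnitVector j v → UnitVector (suc j) ([ 0 ] ∷ v)

  unitVector-∷ʳ : ∀ {m j} {v : V m} → UnitVector j v → UnitVector j (v ∷ʳ [ 0 ])
  unitVector-∷ʳ (unit {m}) rewrite replicate-∷ʳ m [ 0 ] = unit
  unitVector-∷ʳ (zero∷ u) = zero∷ (unitVector-∷ʳ u)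

  unitVector-iter : ∀ j {v : V (suc n)} → UnitVector j v → iter T j v ≡ [ 1 ] ∷ replicate n [ 0 ]
  unitVector-iter zero    unit      = refl
  unitVector-iter (suc j) (zero∷ u) = unitVector-iter j (unitVector-∷ʳ u)

  unitVector-last : ∀ m → UnitVector m (replicate m [ 0 ] ∷ʳ [ 1 ])
  unitVector-last zero    = unit
  unitVector-last (suc m) = zero∷ (unitVector-last m)

  t↑[1+n]≡1 : t ↑ suc n ≡ δ
  t↑[1+n]≡1 = begin
    t ⊗ (t ↑ n)           ≡⟨ cong (t ⊗_) (*-identityʳ (t ↑ n)) ⟨
    t ⊗ ((t ↑ n) ⊗ δ)     ≡⟨ T1⊗ _ ⟩
    T ((t ↑ n) ⊗ δ)       ≡⟨ cong T (t↑⊗ n δ) ⟩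
    T (iter T n δ)        ≡⟨ cong T (unitVector-iter n (unitVector-last n)) ⟩
    δ                     ∎
    where open ≡-Reasoning

  -- Leading j v: the polynomial v is monic of degree n − j.
  data Leading : ∀ {m} → ℕ → V m → Set where
    lead : ∀ {m} {v : V m} → Leading 0 ([ 1 ] ∷ v)
    zero∷ : ∀ {m j} {v : V m} → Leading j v → Leading (suc j) ([ 0 ] ∷ v)

  leading-∷ʳ : ∀ {m j x} {v : V m} → Leading j v → Leading j (v ∷ʳ x)
  leading-∷ʳ lead      = lead
  leading-∷ʳ (zero∷ l) = zero∷ (leading-∷ʳ l)

  leading-T : ∀ {j v} → Leading (suc j) v → Leading j (T v)
  leading-T (zero∷ l) = leading-∷ʳ l

  leading-iter : ∀ k {j v} → Leading (k + j) v → Leading j (iter T k v)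
  leading-iter zero    l = l
  leading-iter (suc k) l = leading-iter k (leading-T l)

  leading-δ : ∀ m → Leading m (replicate m [ 0 ] ∷ʳ [ 1 ])
  leading-δ zero    = lead
  leading-δ (suc m) = zero∷ (leading-δ m)

  -- A smaller index means a larger degree, so the leading term of u survives the subtraction.
  leading-⊖ : ∀ {m j k} {u v : V m} → Leading j u → Leading k v → j < k → Leading j (zipWith _+ₚ_ u (Vec.map -ₚ_ v))
  leading-⊖ (lead {v = u}) (zero∷ {v = v} l) _ = subst (λ x → Leading 0 (x ∷ zipWith _+ₚ_ u (Vec.map -ₚ_ v)))
    (sym (trans (cong ([ 1 ] +ₚ_) -ₚ0≡0) (+ₚ-identityʳ [ 1 ]))) lead
  leading-⊖ (zero∷ {v = u} l) (zero∷ {v = v} l′) (s≤s j<k) = subst (λ x → Leading _ (x ∷ zipWith _+ₚ_ u (Vec.map -ₚ_ v)))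
    (sym (+ₚ-inverseʳ [ 0 ])) (zero∷ (leading-⊖ l l′ j<k))

  leading≢0 : [ 1 ] ≢ [ 0 ] → ∀ {m j} {v : V m} → Leading j v → v ≢ replicate m [ 0 ]
  leading≢0 1≢0 lead      eq = 1≢0 (proj₁ (∷-injective eq))
  leading≢0 1≢0 (zero∷ l) eq = leading≢0 1≢0 l (proj₂ (∷-injective eq))

  module _ (pr : Prime p) (a : ℕ) (pᵃ⁺¹≡ : p ^ suc a ≡ suc (suc n)) where

    -- The Q-th power map is additive by Frobenius, fixes 1, and commutes with T because t^Q = t.
    -- Hence it agrees with the identity on all polynomials in T applied to 1. Coefficients act by
    -- repeated addition, so additivity covers them too.
    ↑pᵃ⁺¹ : ∀ v → v ↑ (suc (suc n)) ≡ v
    ↑pᵃ⁺¹ v = begin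
      φ v                               ≡⟨ cong φ (eval-1 v) ⟨
      φ (eval (coeffs (suc n) v) δ)     ≡⟨ C.eval-commutes φ-⊕ φ-T (coeffs (suc n) v) δ ⟩
      eval (coeffs (suc n) v) (φ δ)     ≡⟨ cong (eval (coeffs (suc n) v)) (1↑ (suc (suc n))) ⟩
      eval (coeffs (suc n) v) δ         ≡⟨ eval-1 v ⟩
      v                                 ∎
      where
      open ≡-Reasoning
      φ : V (suc n) → V (suc n)
      φ v = v ↑ suc (suc n)
      eval-1 : ∀ v → eval (coeffs (suc n) v) δ ≡ v
      eval-1 v = eval-coeffs (suc n) 0 v (ℕ.+-identityʳ (suc n)) none
      1↑ : ∀ k → δ ↑ k ≡ δ
      1↑ zero    = refl
      1↑ (suc k) = trans (*-identityˡ _) (1↑ k)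
      φ-⊕ : C.Additive φ
      φ-⊕ u v = subst (λ q → (zipWith _+ₚ_ u v) ↑ q ≡ zipWith _+ₚ_ (u ↑ q) (v ↑ q)) pᵃ⁺¹≡
        (Frobenius.frobeniusᵃ-+ ring pr p·ᵥ (suc a) u v)
      φ-T : ∀ v → φ (T v) ≡ T (φ v)
      φ-T v = begin
        φ (T v)                               ≡⟨ cong φ (T1⊗ v) ⟨
        φ (t ⊗ v)                             ≡⟨ ^-distrib-* t v (suc (suc n)) ⟩
        φ t ⊗ φ v                             ≡⟨ cong (_⊗ φ v) (trans (cong (t ⊗_) t↑[1+n]≡1) (*-identityʳ t)) ⟩
        t ⊗ φ v                               ≡⟨ T1⊗ (φ v) ⟩
        T (φ v)                               ∎

    -- `Y i` has the factors t^(p^d) - t for 1 ≤ d ≤ i. As Q is `p ^ suc a` here, `Y a` has one for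
    -- each exponent that would make the field too small.
    Y : ℕ → V (suc n)
    Y zero    = δ
    Y (suc i) = zipWith _+ₚ_ (t ↑ (p ^ suc i)) (Vec.map -ₚ_ t) ⊗ Y i

    -- The degree of Y i is geometric i − 1.
    geometric : ℕ → ℕ
    geometric zero    = 1
    geometric (suc i) = p ^ suc i + geometric i

    -- With i = a and `p ^ suc a` = n + 2 this bounds the degree of `Y a` by n, so no coefficient
    -- wraps around in the group algebra.
    geometric< : ∀ i → geometric i < p ^ suc i
    geometric< zero = subst (1 <_) (sym (ℕ.^-identityʳ p)) (1<prime pr)
    geometric< (suc i) = begin-strict
      p ^ suc i + geometric i        <⟨ ℕ.+-monoʳ-< (p ^ suc i) (geometric< i) ⟩
      p ^ suc i + p ^ suc i          ≡⟨ cong (p ^ suc i +_) (ℕ.+-identityʳ _) ⟨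
      2 * p ^ suc i                  ≤⟨ ℕ.*-monoˡ-≤ (p ^ suc i) (1<prime pr) ⟩
      p * p ^ suc i                  ∎
      where open ℕ.≤-Reasoning

    -- Multiplying by t^m or t rotates `Y i`, whose m + j leading zeros absorb the rotation. As m >
    -- 1, the product with t^m has the larger degree.
    leading-Y : ∀ i j → j + geometric i ≡ suc n → Leading j (Y i)
    leading-Y zero j eq = subst (λ j → Leading j δ) (ℕ.suc-injective (trans (sym eq) (ℕ.+-comm j 1))) (leading-δ n)
    leading-Y (suc i) j eq = subst (Leading j) (sym expand)
      (leading-⊖ (leading-iter m l) (leading-T (subst (λ k → Leading (k + j) (Y i)) (sym (ℕ.m+[n∸m]≡n 1≤m)) l)) (ℕ.m<n+m j (ℕ.m<n⇒0<n∸m 1<m)))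
      where
      m = p ^ suc i
      1<m : 1 < m
      1<m = 1<prime^[1+a] pr i
      1≤m = ℕ.<⇒≤ 1<m
      l : Leading (m + j) (Y i)
      l = leading-Y i (m + j) (trans (cong (_+ geometric i) (ℕ.+-comm m j)) (trans (ℕ.+-assoc j m (geometric i)) eq))
      expand : Y (suc i) ≡ zipWith _+ₚ_ (iter T m (Y i)) (Vec.map -ₚ_ (T (Y i)))
      expand = trans ([y-z]x≈yx-zx (Y i) (t ↑ m) t) (cong₂ (λ u v → zipWith _+ₚ_ u (Vec.map -ₚ_ v)) (t↑⊗ m (Y i)) (T1⊗ (Y i)))

    open FiniteRing isCommutativeRing (≡-dec Fin._≟_) (allVec p (suc n)) (allVec! p (suc n)) ∈-allVec
      using (⊗-leftComm; fixedBy; length-fixedBy-∣; module Regular)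
    open Regular n ↑pᵃ⁺¹ using (Primitive; ∃-primitive; ↑N≢0; ↑N-idempotent; module PrimitiveIdempotent)

    e⊗Y≡0 : ∀ {e d} → e ⊗ (t ↑ (p ^ suc d)) ≡ e ⊗ t → ∀ i → d < i → e ⊗ Y i ≡ replicate (suc n) [ 0 ]
    e⊗Y≡0 {e} {d} eq (suc i) (s≤s d≤i) with d ℕ.≟ i
    ... | yes refl = begin
      e ⊗ (zipWith _+ₚ_ (t ↑ (p ^ suc d)) (Vec.map -ₚ_ t) ⊗ Y d)   ≡⟨ *-assoc e _ (Y d) ⟨
      (e ⊗ zipWith _+ₚ_ (t ↑ (p ^ suc d)) (Vec.map -ₚ_ t)) ⊗ Y d   ≡⟨ cong (_⊗ Y d) (x[y-z]≈xy-xz e (t ↑ (p ^ suc d)) t) ⟩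
      zipWith _+ₚ_ (e ⊗ (t ↑ (p ^ suc d))) (Vec.map -ₚ_ (e ⊗ t)) ⊗ Y d ≡⟨ cong (λ u → zipWith _+ₚ_ u (Vec.map -ₚ_ (e ⊗ t)) ⊗ Y d) eq ⟩
      zipWith _+ₚ_ (e ⊗ t) (Vec.map -ₚ_ (e ⊗ t)) ⊗ Y d             ≡⟨ cong (_⊗ Y d) (-‿inverseʳ (e ⊗ t)) ⟩
      replicate (suc n) [ 0 ] ⊗ Y d                                ≡⟨ zeroˡ (Y d) ⟩
      replicate (suc n) [ 0 ]                                      ∎
      where open ≡-Reasoning
    ... | no d≢i = trans (⊗-leftComm e _ (Y i)) (trans (cong (_ ⊗_) (e⊗Y≡0 eq i (ℕ.≤∧≢⇒< d≤i d≢i))) (zeroʳ _))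

    module _ {e : V (suc n)} (e-primitive : Primitive e) (eY≢0 : e ⊗ Y a ≢ replicate (suc n) [ 0 ]) where

      open PrimitiveIdempotent e-primitive
      open Primitive e-primitive

      -- Exponent 0 is impossible because e and 0 are distinct. Otherwise p^s is one more than the
      -- number of units of eR, so `unit-↑-units` gives e t^(p^s) = e t, and s ≤ a would put the
      -- corresponding factor into `Y a`.
      field-exponent> : ∀ s → length (fixedBy e) ≡ p ^ s → a < s
      field-exponent> zero length≡1 = contradiction (∈-length (∈-units⁺ idempotent nonzero))
        (ℕ.<-irrefl (sym (ℕ.suc-injective (trans (sym length-fixedBy) length≡1))))
      field-exponent> (suc d) length≡pᵈ⁺¹ = s≤s (ℕ.≮⇒≥ λ d<a → eY≢0 (e⊗Y≡0 (begin
        e ⊗ (t ↑ (p ^ suc d))          ≡⟨ cong (λ k → e ⊗ (t ↑ k)) (trans (sym length≡pᵈ⁺¹) length-fixedBy) ⟩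
        e ⊗ (t ⊗ (t ↑ length units))   ≡⟨ ⊗-leftComm e t _ ⟩
        t ⊗ (e ⊗ (t ↑ length units))   ≡⟨ cong (t ⊗_) (unit-↑-units t↑[1+n]≡1) ⟩
        t ⊗ e                          ≡⟨ *-comm t e ⟩
        e ⊗ t                          ∎) a d<a))
        where open ≡-Reasoning

      field-order : length (fixedBy e) ≡ p ^ suc a
      field-order = let s , length≡pˢ = ∣prime^⇒prime^ pr (suc n) (subst (length (fixedBy e) ∣_) (length-allVec p (suc n)) (length-fixedBy-∣ idempotent))
        in ℕ.≤-antisym (subst (length (fixedBy e) ≤_) (sym pᵃ⁺¹≡) length-fixedBy-≤)
             (subst (p ^ suc a ≤_) (sym length≡pˢ) (ℕ.^-monoʳ-≤ p (field-exponent> s length≡pˢ)))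

      fieldSlopes-of : SlopeFamily (p ^ suc a) (p ^ suc a)
      fieldSlopes-of = subst (λ q → SlopeFamily q q) field-order slopeFamily

    [1]≢[0] : [ 1 ] ≢ [ 0 ]
    [1]≢[0] eq = case trans (sym (trans (toℕ-[] 1) (m<n⇒m%n≡m (1<prime pr)))) (trans (cong toℕ eq) (trans (toℕ-[] 0) (m*n%n≡0 0 p))) of λ ()

    Y≢0 : Y a ≢ replicate (suc n) [ 0 ]
    Y≢0 = leading≢0 [1]≢[0] (leading-Y a (suc n ∸ geometric a) (ℕ.m∸n+n≡m (s≤s⁻¹ (subst (geometric a <_) pᵃ⁺¹≡ (geometric< a)))))

    -- A power of `Y a` acts as the identity on e, so e cannot annihilate `Y a` without being 0.
    below-Y : ∀ {e} → Primitive e → e ⊗ (Y a ↑ suc n) ≡ e → e ⊗ Y a ≢ replicate (suc n) [ 0 ]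
    below-Y {e} e-primitive eYᴺ≡e eY≡0 = Primitive.nonzero e-primitive (begin
        e                              ≡⟨ eYᴺ≡e ⟨
        e ⊗ (Y a ⊗ (Y a ↑ n))          ≡⟨ *-assoc e (Y a) (Y a ↑ n) ⟨
        (e ⊗ Y a) ⊗ (Y a ↑ n)          ≡⟨ cong (_⊗ (Y a ↑ n)) eY≡0 ⟩
        replicate _ [ 0 ] ⊗ (Y a ↑ n)  ≡⟨ zeroˡ (Y a ↑ n) ⟩
        replicate _ [ 0 ]              ∎)
      where open ≡-Reasoning

    fieldSlopes : SlopeFamily (p ^ suc a) (p ^ suc a)
    fieldSlopes = let e , e-primitive , eYᴺ≡e = ∃-primitive (Y a ↑ suc n) (↑N≢0 Y≢0) (↑N-idempotent (Y a))
      in fieldSlopes-of e-primitive (below-Y e-primitive eYᴺ≡e)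

injective⇒surjective : ∀ {n} {f : Fin n → Fin n} → (∀ {x y} → f x ≡ f y → x ≡ y) → ∀ y → ∃[ x ] f x ≡ y
injective⇒surjective {n} {f} f-inj y with Fin.any? (λ x → f x Fin.≟ y)
... | yes found = found
... | no none = contradiction
  (length-mono-⊆ {xs = y ∷ map f (allFin n)} {ys = allFin n}
    (All.tabulate (λ { z∈ refl → case ∈-map⁻ f z∈ of λ (x , _ , y≡fx) → none (x , sym y≡fx) }) ∷ Unique.map⁺ f-inj (Unique.allFin⁺ n))
    (λ _ → ∈-allFin _))
  (ℕ.<⇒≱ (ℕ.≤-reflexive (cong suc (sym (length-map f (allFin n))))))

-- Slope families for all orders, one field for each prime power

×-isAbelianGroup : {A B : Set} {_⊕_ : A → A → A} {0a : A} {⊖_ : A → A} {_⊞_ : B → B → B} {0b : B} {⊟_ : B → B} →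
  IsAbelianGroup _≡_ _⊕_ 0a ⊖_ → IsAbelianGroup _≡_ _⊞_ 0b ⊟_ →
  IsAbelianGroup {A = A × B} _≡_ (λ (a , b) (a′ , b′) → a ⊕ a′ , b ⊞ b′) (0a , 0b) (λ (a , b) → ⊖ a , ⊟ b)
×-isAbelianGroup G H = record
  { isGroup = record
    { isMonoid = record
      { isSemigroup = record
        { isMagma = record { isEquivalence = isEquivalence ; ∙-cong = λ { refl refl → refl } }
        ; assoc = λ x y z → cong₂ _,_ (G.assoc _ _ _) (H.assoc _ _ _) }
      ; identity = (λ x → cong₂ _,_ (G.identityˡ _) (H.identityˡ _)) , (λ x → cong₂ _,_ (G.identityʳ _) (H.identityʳ _)) }
    ; inverse = (λ x → cong₂ _,_ (G.inverseˡ _) (H.inverseˡ _)) , (λ x → cong₂ _,_ (G.inverseʳ _) (H.inverseʳ _))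
    ; ⁻¹-cong = λ { refl → refl } }
  ; comm = λ x y → cong₂ _,_ (G.comm _ _) (H.comm _ _) }
  where
  module G = IsAbelianGroup G
  module H = IsAbelianGroup H

-- The empty product of fields, which admits any number of slopes since its only element is 0.
trivialSlopes : ∀ m → SlopeFamily 1 m
trivialSlopes m = record
  { Carrier = ⊤ ; _⊕_ = λ _ _ → tt ; 0# = tt ; ⊖_ = λ _ → tt
  ; isAbelianGroup = record
    { isGroup = record
      { isMonoid = record
        { isSemigroup = record
          { isMagma = record { isEquivalence = isEquivalence ; ∙-cong = λ _ _ → refl }
          ; assoc = λ _ _ _ → refl }
        ; identity = (λ _ → refl) , (λ _ → refl) }
      ; inverse = (λ _ → refl) , (λ _ → refl)
      ; ⁻¹-cong = λ _ → refl }
    ; comm = λ _ _ → refl }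
  ; enum = ↔-sym 1↔⊤
  ; slope = λ _ _ → tt ; slope-⊕ = λ _ _ _ → refl ; slope-injective = λ _ _ → refl }

_×-slopes_ : ∀ {n₁ n₂ m} → SlopeFamily n₁ m → SlopeFamily n₂ m → SlopeFamily (n₁ * n₂) m
F ×-slopes G = record
  { isAbelianGroup = ×-isAbelianGroup F.isAbelianGroup G.isAbelianGroup
  ; enum = ↔-sym *↔× ↔-∘ (F.enum ×-↔ G.enum)
  ; slope = λ i (x , y) → F.slope i x , G.slope i y
  ; slope-⊕ = λ i x y → cong₂ _,_ (F.slope-⊕ i _ _) (G.slope-⊕ i _ _)
  ; slope-injective = λ i≢j eq → cong₂ _,_ (F.slope-injective i≢j (cong proj₁ eq)) (G.slope-injective i≢j (cong proj₂ eq)) }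
  where
  module F = SlopeFamily F
  module G = SlopeFamily G

restrictSlopes : ∀ {n m m′} → m′ ≤ m → SlopeFamily n m → SlopeFamily n m′
restrictSlopes m′≤m F = record
  { isAbelianGroup = isAbelianGroup
  ; enum = enum
  ; slope = λ i → slope (inject≤ i m′≤m)
  ; slope-⊕ = λ i → slope-⊕ _
  ; slope-injective = λ i≢j → slope-injective (i≢j ∘ inject≤-injective m′≤m m′≤m _ _) }
  where open SlopeFamily F

primePowerSlopes : ∀ {p} → Prime p → ∀ a → SlopeFamily (p ^ suc a) (p ^ suc a)
primePowerSlopes {p} pr a with p ^ suc a in eq | 1<prime^[1+a] pr a
... | suc zero    | s≤s ()
... | suc (suc n) | _ = subst (λ q → SlopeFamily q q) eq (GroupAlgebra.fieldSlopes p ⦃ prime⇒nonZero pr ⦄ n pr a eq)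

prime-valuation : ∀ {p} → Prime p → ∀ n → .⦃ NonZero n ⦄ → ∃[ a ] ∃[ c ] (n ≡ c * p ^ a × p ∤ c)
prime-valuation {p} pr n = go n (<-wellFounded n)
  where
  go : ∀ n → Acc _<_ n → .⦃ NonZero n ⦄ → ∃[ a ] ∃[ c ] (n ≡ c * p ^ a × p ∤ c)
  go n (acc rec) with p ∣? n
  ... | no p∤n = 0 , n , sym (ℕ.*-identityʳ n) , p∤n
  ... | yes p∣n@(divides q refl) with a , c , q≡ , p∤c ← go q (rec (quotient-< p∣n ⦃ prime⇒nonTrivial pr ⦄)) ⦃ ℕ.m*n≢0⇒m≢0 q ⦄ =
    suc a , c , trans (cong (_* p) q≡) (trans (ℕ.*-assoc c (p ^ a) p) (cong (c *_) (ℕ.*-comm (p ^ a) p))) , p∤c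

∃-prime-divisor : ∀ n → 1 < n → ∃[ p ] (Prime p × p ∣ n)
∃-prime-divisor n 1<n with factorise n ⦃ >-nonZero (ℕ.<⇒≤ 1<n) ⦄
... | record { factors = [] ; isFactorisation = refl } = contradiction 1<n (ℕ.<-irrefl refl)
... | record { factors = p ∷ ps ; isFactorisation = refl ; factorsPrime = pr ∷ _ } = p , pr , m∣m*n _

-- The prime r divides c and so differs from p; splitting off the p-part leaves its exact power
-- unchanged. This hands the minimality hypothesis down to c.
primePowerFactor-*ˡ : ∀ {p} a {c r b} → Prime p → p ∤ c → IsPrimePowerFactor c r b → IsPrimePowerFactor (c * p ^ a) r b
primePowerFactor-*ˡ {p} a {c} {r} {suc b} pr p∤c (r-prime , 1≤b , rᵇ∣c , rᵇ⁺¹∤c) =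
  r-prime , 1≤b , ∣-trans rᵇ∣c (m∣m*n (p ^ a)) ,
  λ rᵇ⁺¹∣ → rᵇ⁺¹∤c (prime^∣-cancelˡ r-prime (suc (suc b)) (r∤pᵃ a) (subst (r ^ suc (suc b) ∣_) (ℕ.*-comm c (p ^ a)) rᵇ⁺¹∣))
  where
  r∤p : r ∤ p
  r∤p r∣p with prime⇒irreducible pr r∣p
  ... | inj₁ refl = ℕ.<-irrefl refl (1<prime r-prime)
  ... | inj₂ refl = p∤c (∣-trans (m∣m*n (r ^ b)) rᵇ∣c)
  r∤pᵃ : ∀ a → r ∤ p ^ a
  r∤pᵃ zero = prime∤1 r-prime
  r∤pᵃ (suc a) r∣ = case euclidsLemma p (p ^ a) r-prime r∣ of λ { (inj₁ r∣p) → r∤p r∣p ; (inj₂ r∣pᵃ) → r∤pᵃ a r∣pᵃ }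

-- Each step splits off a full p-part, whose field has at least m elements and can therefore
-- contribute m slopes.
∃-slopes : ∀ n → .⦃ NonZero n ⦄ → ∀ m → (∀ p a → IsPrimePowerFactor n p a → m ≤ p ^ a) → SlopeFamily n m
∃-slopes n m = go n (<-wellFounded n)
  where
  go : ∀ n → Acc _<_ n → .⦃ NonZero n ⦄ → (∀ p a → IsPrimePowerFactor n p a → m ≤ p ^ a) → SlopeFamily n m
  go (suc zero) _ _ = trivialSlopes m
  go n@(suc (suc _)) (acc rec) m≤ with p , pr , p∣n ← ∃-prime-divisor n (s≤s (s≤s z≤n)) with prime-valuation pr n
  ... | zero , c , n≡c , p∤c = contradiction (subst (p ∣_) (trans n≡c (ℕ.*-identityʳ c)) p∣n) p∤c
  ... | suc a , c , n≡cpᵃ⁺¹ , p∤c = subst (λ n → SlopeFamily n m) (sym n≡cpᵃ⁺¹)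
    (go c (rec c<n) ⦃ c≢0 ⦄ (λ r b rᵇ → m≤ r b (subst (λ n → IsPrimePowerFactor n r b) (sym n≡cpᵃ⁺¹) (primePowerFactor-*ˡ (suc a) pr p∤c rᵇ)))
      ×-slopes restrictSlopes (m≤ p (suc a) factor) (primePowerSlopes pr a))
    where
    instance
      _ = prime⇒nonZero pr
      _ = ℕ.m^n≢0 p (suc a)
    c≢0 : NonZero c
    c≢0 = ℕ.m*n≢0⇒m≢0 c ⦃ subst NonZero n≡cpᵃ⁺¹ _ ⦄
    c<n : c < n
    c<n = subst (c <_) (sym n≡cpᵃ⁺¹) (ℕ.m<m*n c (p ^ suc a) ⦃ c≢0 ⦄ (1<prime^[1+a] pr a))
    factor : IsPrimePowerFactor n p (suc a)
    factor = pr , s≤s z≤n , divides c n≡cpᵃ⁺¹ , λ pᵃ⁺²∣n → p∤c (*-cancelʳ-∣ (p ^ suc a) (subst (p ^ suc (suc a) ∣_) n≡cpᵃ⁺¹ pᵃ⁺²∣n))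

-- The array of a slope family and its translations

module TranslationNet {n m : ℕ} (F : SlopeFamily n m) where

  open SlopeFamily F
  open Inverse enum using (to; from; strictlyInverseˡ; strictlyInverseʳ)
  open IsAbelianGroup isAbelianGroup using (assoc; identityˡ; identityʳ; inverseˡ; inverseʳ)

  private
    abelianGroup : AbelianGroup 0ℓ 0ℓ
    abelianGroup = record { isAbelianGroup = isAbelianGroup }

    planeGroup : AbelianGroup 0ℓ 0ℓ
    planeGroup = record { isAbelianGroup = ×-isAbelianGroup isAbelianGroup isAbelianGroup }

  module Plane = AbelianGroup planeGroup
  open Plane using () renaming (Carrier to Plane; _∙_ to _⊞_; ε to 0²; _⁻¹ to ⊟_)
  open AbelianGroup abelianGroup using (group; commutativeSemigroup)
  open GroupProperties group using (∙-cancelˡ; ∙-cancelʳ; identityˡ-unique; \\-leftDividesʳ; \\-leftDividesˡ)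

  to-injective : ∀ {x y} → to x ≡ to y → x ≡ y
  to-injective {x} {y} eq = trans (sym (strictlyInverseʳ x)) (trans (cong from eq) (strictlyInverseʳ y))

  -- The fibres of each map are a parallel class of lines of the plane: the vertical class first,
  -- then one class per slope.
  lin : Fin (suc m) → Plane → Carrier
  lin zero    (x , y) = x
  lin (suc i) (x , y) = y ⊕ slope i x

  lin-⊞ : ∀ i s t → lin i (s ⊞ t) ≡ lin i s ⊕ lin i t
  lin-⊞ zero    s t = refl
  lin-⊞ (suc i) (x , y) (x′ , y′) = trans (cong ((y ⊕ y′) ⊕_) (slope-⊕ i x x′)) (interchange y y′ (slope i x) (slope i x′))
    where open CommutativeSemigroupProperties commutativeSemigroup using (interchange)

  lin-0 : ∀ i → lin i 0² ≡ 0#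
  lin-0 i = identityˡ-unique (lin i 0²) (lin i 0²) (trans (sym (lin-⊞ i 0² 0²)) (cong (lin i) (Plane.identityˡ 0²)))

  slope-0 : ∀ i → slope i 0# ≡ 0#
  slope-0 i = trans (sym (identityˡ _)) (lin-0 (suc i))

  lin-⊟-⊕ : ∀ i d x → lin i (⊟ d) ⊕ (lin i d ⊕ x) ≡ x
  lin-⊟-⊕ i d x = begin
    lin i (⊟ d) ⊕ (lin i d ⊕ x)   ≡⟨ assoc _ _ x ⟨
    (lin i (⊟ d) ⊕ lin i d) ⊕ x   ≡⟨ cong (_⊕ x) (lin-⊞ i (⊟ d) d) ⟨
    lin i ((⊟ d) ⊞ d) ⊕ x         ≡⟨ cong (λ s → lin i s ⊕ x) (Plane.inverseˡ d) ⟩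
    lin i 0² ⊕ x                  ≡⟨ cong (_⊕ x) (lin-0 i) ⟩
    0# ⊕ x                        ≡⟨ identityˡ x ⟩
    x                             ∎
    where open ≡-Reasoning

  lin-kernel : ∀ {i j} → i ≢ j → ∀ d → lin i d ≡ 0# → lin j d ≡ 0# → d ≡ 0²
  lin-kernel {zero}  {zero}  i≢j _ _ _ = contradiction refl i≢j
  lin-kernel {zero}  {suc j} _ (x , y) refl y≡0 = cong (0# ,_) (trans (sym (identityʳ y)) (trans (cong (y ⊕_) (sym (slope-0 j))) y≡0))
  lin-kernel {suc i} {zero}  _ (x , y) y≡0 refl = cong (0# ,_) (trans (sym (identityʳ y)) (trans (cong (y ⊕_) (sym (slope-0 i))) y≡0))
  lin-kernel {suc i} {suc j} i≢j (x , y) eqᵢ eqⱼ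
    with refl ← slope-injective (i≢j ∘ cong suc) (∙-cancelˡ y _ _ (trans eqᵢ (sym eqⱼ))) =
    cong (0# ,_) (trans (sym (identityʳ y)) (trans (cong (y ⊕_) (sym (slope-0 i))) eqᵢ))

  lin-injective : ∀ {i j} → i ≢ j → ∀ {s t} → lin i s ≡ lin i t → lin j s ≡ lin j t → s ≡ t
  lin-injective {i} {j} i≢j {s} {t} eqᵢ eqⱼ = sym (begin
    t                    ≡⟨ PlaneProperties.\\-leftDividesˡ s t ⟨
    s ⊞ ((⊟ s) ⊞ t)      ≡⟨ cong (s ⊞_) (lin-kernel i≢j ((⊟ s) ⊞ t) (vanishes i eqᵢ) (vanishes j eqⱼ)) ⟩
    s ⊞ 0²               ≡⟨ Plane.identityʳ s ⟩
    s                    ∎)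
    where
    open ≡-Reasoning
    module PlaneProperties = GroupProperties Plane.group
    vanishes : ∀ i → lin i s ≡ lin i t → lin i ((⊟ s) ⊞ t) ≡ 0#
    vanishes i eq = trans (lin-⊞ i (⊟ s) t) (trans (cong (lin i (⊟ s) ⊕_) (trans (sym eq) (sym (identityʳ _)))) (lin-⊟-⊕ i s 0#))

  -- Injectivity comes from the trivial common kernel. Surjectivity is a count, with both sides
  -- coded by `Fin (n * n)`.
  lin-bijective : ∀ i j → i ≢ j → Bijective _≡_ _≡_ (λ s → to (lin i s) , to (lin j s))
  lin-bijective i j i≢j = injective , λ xy →
      let c , eq = injective⇒surjective {f = encode ∘ f ∘ decode}
                     (λ {c} {c′} eq → decode-injective (injective (encode-injective {f (decode c)} {f (decode c′)} eq))) (encode xy)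
      in decode c , λ { refl → encode-injective eq }
    where
    f : Plane → Fin n × Fin n
    f s = to (lin i s) , to (lin j s)
    injective : ∀ {s t} → f s ≡ f t → s ≡ t
    injective eq = let eqᵢ , eqⱼ = ,-injective eq in lin-injective i≢j (to-injective eqᵢ) (to-injective eqⱼ)
    open Inverse (*↔× {n} {n}) using () renaming (from to encode; to to fromCode; strictlyInverseˡ to fromCode-encode; strictlyInverseʳ to encode-fromCode)
    encode-injective : ∀ {x y} → encode x ≡ encode y → x ≡ y
    encode-injective {x} {y} eq = trans (sym (fromCode-encode x)) (trans (cong fromCode eq) (fromCode-encode y))
    decode : Fin (n * n) → Plane
    decode c = let x , y = fromCode c in from x , from y
    decode-injective : ∀ {c c′} → decode c ≡ decode c′ → c ≡ c′
    decode-injective {c} {c′} eq = let eq₁ , eq₂ = ,-injective eq in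
      trans (sym (encode-fromCode c)) (trans (cong encode (cong₂ _,_ (from-injective eq₁) (from-injective eq₂))) (encode-fromCode c′))
      where
      from-injective : ∀ {x y} → from x ≡ from y → x ≡ y
      from-injective {x} {y} eq = trans (sym (strictlyInverseˡ x)) (trans (cong to eq) (strictlyInverseˡ y))

  net : OrthogonalArray (suc m) n
  net = record { S = Plane ; π = λ i s → to (lin i s) ; orth = lin-bijective }

  -- Membership is pointwise agreement with a translation, since permutations are compared only
  -- through their values.
  TranslatesBy : Plane → Tuple net → Set
  TranslatesBy d σ = ∀ i z → σ i ⟨$⟩ʳ z ≡ to (lin i d ⊕ from z)

  translates-sends : ∀ {d σ} → TranslatesBy d σ → ∀ s → Sends net σ s (d ⊞ s)
  translates-sends {d} {σ} σ-d s i = trans (cong to (lin-⊞ i d s))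
    (trans (cong (λ x → to (lin i d ⊕ x)) (sym (strictlyInverseʳ (lin i s)))) (sym (σ-d i _)))

  translation : Plane → Tuple net
  translation d i = permutation (λ z → to (lin i d ⊕ from z)) (λ z → to ((⊖ lin i d) ⊕ from z))
    (λ z → trans (cong (λ x → to (lin i d ⊕ x)) (strictlyInverseʳ _)) (trans (cong to (\\-leftDividesˡ (lin i d) (from z))) (strictlyInverseˡ z)))
    (λ z → trans (cong (λ x → to ((⊖ lin i d) ⊕ x)) (strictlyInverseʳ _)) (trans (cong to (\\-leftDividesʳ (lin i d) (from z))) (strictlyInverseˡ z)))

  ⊞-⊟-cancel : ∀ d t → d ⊞ ((⊟ d) ⊞ t) ≡ t
  ⊞-⊟-cancel = GroupProperties.\\-leftDividesˡ Plane.group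

  translations : AutotopySubgroup net
  translations = record
    { Mem = λ σ → ∃[ d ] TranslatesBy d σ
    ; mem-aut = λ σ (d , σ-d) → (λ s → d ⊞ s , translates-sends {σ = σ} σ-d s)
        , λ t → (⊟ d) ⊞ t , subst (Sends net σ ((⊟ d) ⊞ t)) (⊞-⊟-cancel d t) (translates-sends {σ = σ} σ-d _)
    ; mem-id = 0² , λ i z → sym (trans (cong (λ x → to (x ⊕ from z)) (lin-0 i)) (trans (cong to (identityˡ (from z))) (strictlyInverseˡ z)))
    ; mem-∘ = λ σ τ (d , σ-d) (d′ , τ-d′) → d′ ⊞ d , λ i z → begin
        τ i ⟨$⟩ʳ (σ i ⟨$⟩ʳ z)                              ≡⟨ τ-d′ i _ ⟩
        to (lin i d′ ⊕ from (σ i ⟨$⟩ʳ z))                 ≡⟨ cong (λ w → to (lin i d′ ⊕ from w)) (σ-d i z) ⟩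
        to (lin i d′ ⊕ from (to (lin i d ⊕ from z)))      ≡⟨ cong (λ x → to (lin i d′ ⊕ x)) (strictlyInverseʳ _) ⟩
        to (lin i d′ ⊕ (lin i d ⊕ from z))                ≡⟨ cong to (assoc _ _ _) ⟨
        to ((lin i d′ ⊕ lin i d) ⊕ from z)                ≡⟨ cong (λ x → to (x ⊕ from z)) (lin-⊞ i d′ d) ⟨
        to (lin i (d′ ⊞ d) ⊕ from z)                      ∎
    ; mem-inv = λ σ (d , σ-d) → ⊟ d , λ i z → sym (begin
        to (lin i (⊟ d) ⊕ from z)                                     ≡⟨ cong (λ w → to (lin i (⊟ d) ⊕ from w)) (Permutation.inverseʳ (σ i)) ⟨
        to (lin i (⊟ d) ⊕ from (σ i ⟨$⟩ʳ (σ i ⟨$⟩ˡ z)))                 ≡⟨ cong (λ w → to (lin i (⊟ d) ⊕ from w)) (σ-d i _) ⟩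
        to (lin i (⊟ d) ⊕ from (to (lin i d ⊕ from (σ i ⟨$⟩ˡ z))))     ≡⟨ cong (λ x → to (lin i (⊟ d) ⊕ x)) (strictlyInverseʳ _) ⟩
        to (lin i (⊟ d) ⊕ (lin i d ⊕ from (σ i ⟨$⟩ˡ z)))               ≡⟨ cong to (lin-⊟-⊕ i d _) ⟩
        to (from (σ i ⟨$⟩ˡ z))                                        ≡⟨ strictlyInverseˡ _ ⟩
        σ i ⟨$⟩ˡ z                                                    ∎)
    }
    where open ≡-Reasoning

  net-simplyTransitive : IsSimplyTransitive net
  net-simplyTransitive = translations
    , (λ s t → let d = t ⊞ (⊟ s) in translation d , (d , λ _ _ → refl) ,
         subst (Sends net (translation d) s) (GroupProperties.//-rightDividesˡ Plane.group s t) (translates-sends {d} {translation d} (λ _ _ → refl) s))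
    -- In each coordinate the image of s determines the amount `lin i d` of the translation by
    -- cancellation, hence the whole permutation.
    , λ s t σ τ (d , σ-d) (d′ , τ-d′) sends sends′ i z → trans (σ-d i z) (trans
        (cong (λ x → to (x ⊕ from z)) (∙-cancelʳ (from (to (lin i s))) _ _ (to-injective
          (trans (sym (σ-d i _)) (trans (sym (sends i)) (trans (sends′ i) (τ-d′ i _)))))))
        (sym (τ-d′ i z)))

theorem4p6 : ∀ (n m : ℕ) → 2 ≤ n → IsMinPrimePowerFactor n m →
    IsMaxSTMOLS n (m ∸ 1)
theorem4p6 n m 2≤n ((p , zero , (_ , () , _) , _) , _)
theorem4p6 n m 2≤n ((p , suc a , factor@(pr , _) , refl) , minimal) = exists , bound
  where
  instance
    _ = >-nonZero (ℕ.<⇒≤ 2≤n)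
  existsNet : ∀ m′ → m′ ≡ p ^ suc a → ExistsSTMOLS (m′ ∸ 1) n
  existsNet zero      eq = contradiction (subst (1 <_) (sym eq) (1<prime^[1+a] pr a)) λ ()
  -- The m′ + 1 slopes give m′ + 2 coordinates, that is, m′ squares.
  existsNet (suc m′)  eq = subst (λ k → Σ (OrthogonalArray k n) IsSimplyTransitive) (ℕ.+-comm 2 m′)
    (net , net-simplyTransitive)
    where open TranslationNet (subst (SlopeFamily n) (sym eq) (∃-slopes n (p ^ suc a) minimal))
  exists : ExistsSTMOLS (p ^ suc a ∸ 1) n
  exists = existsNet (p ^ suc a) refl
  bound : ∀ q → ExistsSTMOLS q n → q ≤ p ^ suc a ∸ 1
  -- Writing q + 2 as 2 + q exposes two distinct coordinates, `zero` and `suc zero`, to code the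
  -- points by; `fromℕ<` supplies a symbol for the base point.
  bound q mols with A , st ← subst (λ k → Σ (OrthogonalArray k n) IsSimplyTransitive) (ℕ.+-comm q 2) mols =
    ℕ.∸-monoˡ-≤ 1 (s≤s⁻¹ (coordinates-bound A st {zero} {suc zero} (λ ()) (fromℕ< (ℕ.<⇒≤ 2≤n)) a factor))
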